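{- For a matroid $M$ and nonnegative integers $k,s,c$ with $k\le r(M)$, let $f_k(s,c)$ be the number of rank-$k$ flats $X$ of $M$ of size $s$ such that the restriction $M|X$ has exactly $c$ coloops. The number $f_k(s,c)$ is derivable from the $\mathcal{G}$-invariant of $M$; that is, if $M$ and $M'$ are matroids with $\mathcal{G}(M)=\mathcal{G}(M')$, then the numbers $f_k(s,c)$ for $M$ and for $M'$ are equal for all $k,s,c$.
   Context: $\mathcal{G}(n,r)$ is the vector space over a field of characteristic zero with basis the formal symbols $[\underline{r}]$, one for each $0,1$-sequence of length $n$ with exactly $r$ ones. For a rank-$r$ matroid $M$ with rank function $r(\cdot)$ on an $n$-element set $E$ and a permutation (linear ordering) $\pi$ of $E$, the rank sequence $\underline{r}(\pi)=r_1\ldots r_n$ has $r_1=r(\{\pi(1)\})$ and $r_j=r(\{\pi(1),\ldots,\pi(j)\})-r(\{\pi(1),\ldots,\pi(j-1)\})$ for $j\ge2$. The $\mathcal{G}$-invariant is $\mathcal{G}(M)=\sum_\pi[\underline{r}(\pi)]\in\mathcal{G}(n,r)$, over all $n!$ permutations of $E$. (Note that $f_k(s,0)$ is the number of cyclic flats, i.e. flats $X$ with $M|X$ coloop-free, of rank $k$ and size $s$.) -}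

module Defs where

open import Level using (Level)
open import Algebra.Apartness.Bundles using (HeytingField; HeytingCommutativeRing)
open import Algebra.Bundles using (CommutativeRing)
open import Algebra.Module.Bundles using (LeftModule)
import Algebra.Construct.Pointwise as Pointwise
import Algebra.Definitions.RawMonoid as RawMonoidDefs
open import Data.Bool.Base using (if_then_else_)
open import Data.Bool.Properties using (T-≡)
open import Data.Fin.Base using (Fin; zero; suc; toℕ; fromℕ<; punchIn)
import Data.Fin.Properties as Fin
open import Data.Fin.Permutation
  using (Permutation′; _⟨$⟩ʳ_; _⟨$⟩ˡ_; id; insert; remove; _≈_; inverseʳ; insert-punchIn; insert-remove)
open import Data.Fin.Subset
  using (Subset; inside; outside; ⊤; ⊥; ⁅_⁆; _∪_; _∩_; ∣_∣; _∈_; _∉_; _⊆_)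
open import Data.Fin.Subset.Properties
  using (_∈?_; _⊆?_; anySubset?; ⊆⊤; ∣⊥∣≡0; ∣⁅x⁆∣≡1; x∈⁅x⁆; x∈p∪q⁺)
open import Data.List.Base using (List; []; _∷_; _++_; map; filter; foldr; length; cartesianProductWith; allFin)
open import Data.List.Membership.Propositional.Properties using (∈-allFin)
open import Data.List.Properties using (length-++; length-map; length-tabulate)
open import Data.List.Relation.Unary.Any as Any using (Any; here)
import Data.List.Relation.Unary.Any.Properties as Any
open import Data.Nat.Base using (ℕ; zero; suc; _+_; _*_; _∸_; _≤_; _<_; s≤s; _!)
open import Data.Nat.Properties
open import Data.Product.Base using (∃; _×_; _,_; proj₁; proj₂)
open import Data.Sum.Base using (inj₁; inj₂)
open import Data.Vec.Base using (Vec; []; _∷_; tabulate; count)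
open import Data.Vec.Properties using (≡-dec; lookup∘tabulate; []=⇒lookup; lookup⇒[]=)
open import Function.Base using (_∘_)
open import Function.Bundles using (Equivalence)
open import Relation.Binary.PropositionalEquality hiding ([_])
open import Relation.Nullary
open import Relation.Nullary.Decidable using (map′; decidable-stable; dec-true)
open import Relation.Unary using (Decidable)

private
  variable
    n r : ℕ

------------------------------------------------------------------------
-- Matroids

-- The ground set E is a subset of Fin n, so that a restriction lives on
-- the same Fin n.  Only the values of rank on subsets of E are meaningful.

record Matroid (E : Subset n) : Set where
  field
    rank            : Subset n → ℕ
    rank≤∣∣         : ∀ {X} → X ⊆ E → rank X ≤ ∣ X ∣
    rank-mono       : ∀ {X Y} → X ⊆ Y → Y ⊆ E → rank X ≤ rank Y
    rank-submodular : ∀ {X Y} → X ⊆ E → Y ⊆ E →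
                      rank (X ∪ Y) + rank (X ∩ Y) ≤ rank X + rank Y

open Matroid public

rk : {E : Subset n} → Matroid E → ℕ
rk {E = E} M = rank M E

restrict : {E : Subset n} → Matroid E → (X : Subset n) → X ⊆ E → Matroid X
restrict M X X⊆E = record
  { rank            = rank M
  ; rank≤∣∣         = λ Y⊆X → rank≤∣∣ M (X⊆E ∘ Y⊆X)
  ; rank-mono       = λ Y⊆Z Z⊆X → rank-mono M Y⊆Z (X⊆E ∘ Z⊆X)
  ; rank-submodular = λ Y⊆X Z⊆X → rank-submodular M (X⊆E ∘ Y⊆X) (X⊆E ∘ Z⊆X)
  }

IsFlat : {E : Subset n} → Matroid E → Subset n → Set
IsFlat {E = E} M X = X ⊆ E × (∀ e → e ∈ E → e ∉ X → rank M X < rank M (X ∪ ⁅ e ⁆))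

-- A basis is an independent set (rank B ≡ ∣ B ∣) that spans E.

IsBasis : {E : Subset n} → Matroid E → Subset n → Set
IsBasis {E = E} M B = B ⊆ E × rank M B ≡ ∣ B ∣ × rank M B ≡ rk M

IsColoop : {E : Subset n} → Matroid E → Fin n → Set
IsColoop {E = E} M e = e ∈ E × (∀ B → IsBasis M B → e ∈ B)

isFlat? : {E : Subset n} (M : Matroid E) → Decidable (IsFlat M)
isFlat? {E = E} M X =
  X ⊆? E ×-dec
  Fin.all? λ e → e ∈? E →-dec ¬? (e ∈? X) →-dec rank M X <? rank M (X ∪ ⁅ e ⁆)

isBasis? : {E : Subset n} (M : Matroid E) → Decidable (IsBasis M)
isBasis? {E = E} M B = B ⊆? E ×-dec rank M B ≟ ∣ B ∣ ×-dec rank M B ≟ rk M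

isColoop? : {E : Subset n} (M : Matroid E) → Decidable (IsColoop M)
isColoop? {E = E} M e = e ∈? E ×-dec map′
  (λ ∄B B basis → decidable-stable (e ∈? B) λ e∉B → ∄B (B , basis , e∉B))
  (λ all (B , basis , e∉B) → e∉B (all B basis))
  (¬? (anySubset? λ B → isBasis? M B ×-dec ¬? (e ∈? B)))

coloops : {E : Subset n} → Matroid E → Subset n
coloops M = tabulate (does ∘ isColoop? M)

allSubsets : ∀ n → List (Subset n)
allSubsets zero    = [] ∷ []
allSubsets (suc n) = map (inside ∷_) (allSubsets n) ++ map (outside ∷_) (allSubsets n)

flatCount : Matroid (⊤ {n}) → (k s c : ℕ) → ℕ
flatCount M k s c = length (filter counted? (allSubsets _))
  where
  counted? : Decidable λ X →
    IsFlat M X × rank M X ≡ k × ∣ X ∣ ≡ s × ∣ coloops (restrict M X ⊆⊤) ∣ ≡ c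
  counted? X =
    isFlat? M X ×-dec rank M X ≟ k ×-dec ∣ X ∣ ≟ s ×-dec ∣ coloops (restrict M X ⊆⊤) ∣ ≟ c

------------------------------------------------------------------------
-- Permutations

permutations : ∀ n → List (Permutation′ n)
permutations zero    = id ∷ []
permutations (suc n) = cartesianProductWith (insert zero) (allFin (suc n)) (permutations n)

-- Every permutation is listed, and the list has length n !, so each
-- permutation is listed exactly once up to pointwise equality.

permutations-complete : (π : Permutation′ n) → Any (π ≈_) (permutations n)
permutations-complete {zero}  π = here λ ()
permutations-complete {suc n} π =
  Any.cartesianProductWith⁺ (insert zero) combine
    (∈-allFin (π ⟨$⟩ʳ zero)) (permutations-complete (remove zero π))
  where
  combine : ∀ {j ρ} → π ⟨$⟩ʳ zero ≡ j → remove zero π ≈ ρ → π ≈ insert zero j ρ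
  combine refl eq zero    = refl
  combine {j} {ρ} refl eq (suc i) = begin
    π ⟨$⟩ʳ suc i                             ≡⟨ insert-remove zero π (suc i) ⟨
    insert zero j (remove zero π) ⟨$⟩ʳ suc i ≡⟨ insert-punchIn zero j (remove zero π) i ⟩
    punchIn j (remove zero π ⟨$⟩ʳ i)         ≡⟨ cong (punchIn j) (eq i) ⟩
    punchIn j (ρ ⟨$⟩ʳ i)                     ≡⟨ insert-punchIn zero j ρ i ⟨
    insert zero j ρ ⟨$⟩ʳ suc i               ∎
    where open ≡-Reasoning

length-permutations : ∀ n → length (permutations n) ≡ n !
length-permutations zero    = refl
length-permutations (suc n) = trans
  (length-product (allFin (suc n)) (permutations n))
  (cong₂ _*_ (length-tabulate {n = suc n} (λ i → i)) (length-permutations n))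
  where
  length-product : ∀ xs (ys : List (Permutation′ n)) →
    length (cartesianProductWith (insert zero) xs ys) ≡ length xs * length ys
  length-product []       ys = refl
  length-product (x ∷ xs) ys = trans
    (length-++ (map (insert zero x) ys))
    (cong₂ _+_ (length-map (insert zero x) ys) (length-product xs ys))

------------------------------------------------------------------------
-- Rank sequences

ones : Vec (Fin 2) n → ℕ
ones = count (Fin._≟ suc zero)

-- prefix π j = { π(1), …, π(j) }, i.e. the e whose position π⁻¹(e),
-- counted from 0, is below j.

prefix : Permutation′ n → ℕ → Subset n
prefix π j = tabulate λ e → does (toℕ (π ⟨$⟩ˡ e) <? j)

-- Positions are 0-based.  At j = 0 the subtracted term is the rank of the
-- empty set, which is 0.

increment : Matroid (⊤ {n}) → Permutation′ n → ℕ → ℕ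
increment M π j = rank M (prefix π (suc j)) ∸ rank M (prefix π j)

module _ (π : Permutation′ n) where

  ∈-prefix⁺ : ∀ {e j} → toℕ (π ⟨$⟩ˡ e) < j → e ∈ prefix π j
  ∈-prefix⁺ {e} {j} lt = lookup⇒[]= e _
    (trans (lookup∘tabulate _ e) (dec-true (toℕ (π ⟨$⟩ˡ e) <? j) lt))

  ∈-prefix⁻ : ∀ {e j} → e ∈ prefix π j → toℕ (π ⟨$⟩ˡ e) < j
  ∈-prefix⁻ {e} {j} e∈ = <ᵇ⇒< (toℕ (π ⟨$⟩ˡ e)) j
    (Equivalence.from T-≡ (trans (sym (lookup∘tabulate _ e)) ([]=⇒lookup e∈)))

  prefix-mono : ∀ j → prefix π j ⊆ prefix π (suc j)
  prefix-mono j e∈ = ∈-prefix⁺ (m<n⇒m<1+n (∈-prefix⁻ e∈))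

  prefix-suc : ∀ (i : Fin n) → prefix π (suc (toℕ i)) ⊆ prefix π (toℕ i) ∪ ⁅ π ⟨$⟩ʳ i ⁆
  prefix-suc i {e} e∈ with m≤n⇒m<n∨m≡n (≤-pred (∈-prefix⁻ e∈))
  ... | inj₁ lt = x∈p∪q⁺ (inj₁ (∈-prefix⁺ lt))
  ... | inj₂ eq = x∈p∪q⁺ {p = prefix π (toℕ i)}
    (inj₂ (subst (λ x → e ∈ ⁅ x ⁆)
      (trans (sym (inverseʳ π)) (cong (π ⟨$⟩ʳ_) (Fin.toℕ-injective eq))) (x∈⁅x⁆ e)))

module _ (M : Matroid (⊤ {n})) where

  rank-⊥ : ∀ {X} → X ⊆ ⊥ → rank M X ≡ 0
  rank-⊥ X⊆⊥ = n≤0⇒n≡0 (≤-trans (rank-mono M X⊆⊥ ⊆⊤)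
    (≤-trans (rank≤∣∣ M ⊆⊤) (≤-reflexive (∣⊥∣≡0 n))))

  rank-∪⁅⁆ : ∀ X e → rank M (X ∪ ⁅ e ⁆) ≤ suc (rank M X)
  rank-∪⁅⁆ X e = begin
    rank M (X ∪ ⁅ e ⁆)                      ≤⟨ m≤m+n _ _ ⟩
    rank M (X ∪ ⁅ e ⁆) + rank M (X ∩ ⁅ e ⁆) ≤⟨ rank-submodular M ⊆⊤ ⊆⊤ ⟩
    rank M X + rank M ⁅ e ⁆                 ≤⟨ +-monoʳ-≤ (rank M X) (rank≤∣∣ M ⊆⊤) ⟩
    rank M X + ∣ ⁅ e ⁆ ∣                    ≡⟨ cong (rank M X +_) (∣⁅x⁆∣≡1 e) ⟩
    rank M X + 1                            ≡⟨ +-comm (rank M X) 1 ⟩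
    suc (rank M X)                          ∎
    where open ≤-Reasoning

  increment<2 : ∀ π (i : Fin n) → increment M π (toℕ i) < 2
  increment<2 π i = s≤s (m≤n+o⇒m∸n≤o _ (rank M (prefix π (toℕ i)))
    (≤-trans (rank-mono M (prefix-suc π i) ⊆⊤)
      (≤-trans (rank-∪⁅⁆ _ _) (≤-reflexive (+-comm 1 _)))))

rankSequence : Matroid (⊤ {n}) → Permutation′ n → Vec (Fin 2) n
rankSequence M π = tabulate λ i → fromℕ< (increment<2 M π i)

telescope : ∀ n (g : ℕ → ℕ) → (∀ j → g j ≤ g (suc j)) →
            (lt : ∀ (i : Fin n) → g (suc (toℕ i)) ∸ g (toℕ i) < 2) →
            ones (tabulate λ i → fromℕ< (lt i)) + g 0 ≡ g n
telescope zero    g mono lt = refl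
telescope (suc n) g mono lt = trans
  (step (g 1 ∸ g 0) refl (lt zero) (ones (tabulate λ i → fromℕ< (lt (suc i)))))
  (telescope n (g ∘ suc) (mono ∘ suc) (lt ∘ suc))
  where
  step : ∀ d → d ≡ g 1 ∸ g 0 → (d<2 : d < 2) → ∀ t →
         (if does (fromℕ< d<2 Fin.≟ suc zero) then suc else λ m → m) t + g 0 ≡ t + g 1
  step 0 eq lt′ t = cong (t +_) (≤-antisym (mono 0) (m∸n≡0⇒m≤n (sym eq)))
  step 1 eq lt′ t = trans (sym (+-suc t (g 0)))
    (cong (t +_) (trans (cong (_+ g 0) eq) (m∸n+n≡m (mono 0))))
  step (suc (suc d)) eq (s≤s (s≤s ())) t

ones-rankSequence : (M : Matroid (⊤ {n})) (π : Permutation′ n) → ones (rankSequence M π) ≡ rk M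
ones-rankSequence {n} M π = begin
  ones (rankSequence M π)                       ≡⟨ +-identityʳ _ ⟨
  ones (rankSequence M π) + 0                   ≡⟨ cong (ones (rankSequence M π) +_) empty ⟨
  ones (rankSequence M π) + rank M (prefix π 0) ≡⟨ telescope n (rank M ∘ prefix π)
                                                     (λ j → rank-mono M (prefix-mono π j) ⊆⊤)
                                                     (increment<2 M π) ⟩
  rank M (prefix π n)                           ≡⟨ full ⟩
  rk M                                          ∎
  where
  open ≡-Reasoning
  empty : rank M (prefix π 0) ≡ 0
  empty = rank-⊥ M λ e∈ → contradiction (∈-prefix⁻ π {j = 0} e∈) λ ()
  full : rank M (prefix π n) ≡ rk M
  full = ≤-antisym (rank-mono M ⊆⊤ ⊆⊤)
    (rank-mono M (λ {e} _ → ∈-prefix⁺ π (Fin.toℕ<n (π ⟨$⟩ˡ e))) ⊆⊤)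

-- The index set of the basis of 𝒢(n,r).

Symbol : ℕ → ℕ → Set
Symbol n r = ∃ λ (v : Vec (Fin 2) n) → ones v ≡ r

rankSymbol : (M : Matroid (⊤ {n})) → rk M ≡ r → Permutation′ n → Symbol n r
rankSymbol M rk≡r π = rankSequence M π , trans (ones-rankSequence M π) rk≡r

------------------------------------------------------------------------
-- The 𝒢-invariant

module _ {a ℓ₁ ℓ₂ : Level} (K : HeytingField a ℓ₁ ℓ₂) where

  private
    commutativeRing : CommutativeRing a ℓ₁
    commutativeRing = HeytingCommutativeRing.commutativeRing (HeytingField.heytingCommutativeRing K)
    module K = CommutativeRing commutativeRing

  CharacteristicZero : Set ℓ₁
  CharacteristicZero = ∀ m → ¬ (suc m ×ᴷ K.1# K.≈ K.0#)
    where open RawMonoidDefs K.+-rawMonoid renaming (_×_ to _×ᴷ_)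

  -- Symbol n r is finite, so the vector space with basis Symbol n r consists
  -- of all coordinate functions on Symbol n r.

  𝒢 : ℕ → ℕ → LeftModule K.ring a ℓ₁
  𝒢 n r = record
    { Carrierᴹ     = Symbol n r → K.Carrier
    ; _≈ᴹ_         = λ u v → ∀ s → u s K.≈ v s
    ; _+ᴹ_         = λ u v s → u s K.+ v s
    ; _*ₗ_         = λ x v s → x K.* v s
    ; 0ᴹ           = λ s → K.0#
    ; -ᴹ_          = λ v s → K.- v s
    ; isLeftModule = record
      { isLeftSemimodule = record
        { +ᴹ-isCommutativeMonoid =
            Pointwise.isCommutativeMonoid (Symbol n r) K.+-isCommutativeMonoid
        ; isPreleftSemimodule = record
          { *ₗ-cong      = λ x≈y u≈v s → K.*-cong x≈y (u≈v s)
          ; *ₗ-zeroˡ     = λ v s → K.zeroˡ (v s)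
          ; *ₗ-distribʳ  = λ v x y s → K.distribʳ (v s) x y
          ; *ₗ-identityˡ = λ v s → K.*-identityˡ (v s)
          ; *ₗ-assoc     = λ x y v s → K.*-assoc x y (v s)
          ; *ₗ-zeroʳ     = λ x s → K.zeroʳ x
          ; *ₗ-distribˡ  = λ x u v s → K.distribˡ x (u s) (v s)
          }
        }
      ; -ᴹ‿cong    = λ u≈v s → K.-‿cong (u≈v s)
      ; -ᴹ‿inverse = (λ v s → K.-‿inverseˡ (v s)) , (λ v s → K.-‿inverseʳ (v s))
      }
    }

  -- Comparing the underlying sequences suffices: equality on ℕ is
  -- proof-irrelevant.

  [_] : Symbol n r → LeftModule.Carrierᴹ (𝒢 n r)
  [ s ] t = if does (≡-dec Fin._≟_ (proj₁ s) (proj₁ t)) then K.1# else K.0#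

  𝒢-invariant : (M : Matroid (⊤ {n})) → rk M ≡ r → LeftModule.Carrierᴹ (𝒢 n r)
  𝒢-invariant {n} {r} M rk≡r =
    foldr (λ π v → [ rankSymbol M rk≡r π ] +ᴹ v) 0ᴹ (permutations n)
    where open LeftModule (𝒢 n r)

{-# OPTIONS --safe #-}

-- By characteristic zero the 𝒢-invariant determines how many orderings have a given rank
-- sequence.  In an ordering whose first s elements form a set X of rank k, the last j
-- elements of X all increase the rank iff they are coloops of M|X, and the next m elements all
-- fail to increase it iff they are loops of M/X.  The number of orderings of this kind with given
-- X depends only on the number c of coloops of M|X and the number l of loops of M/X; it vanishes
-- if c < j or l < m, and is positive if c = j and l = m.  So the totals over X, for all j and m,
-- form a triangular system that determines the number of sets X with given (c , l), and
-- X is a flat iff l = 0.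

module Submission where

open import Defs
open import Algebra.Apartness.Bundles using (HeytingField; HeytingCommutativeRing)
open import Algebra.Bundles using (CommutativeRing)
import Algebra.Definitions.RawMonoid as RawMonoidDefs
open import Algebra.Module.Bundles using (LeftModule)
import Algebra.Properties.AbelianGroup as AbelianGroupProperties
open import Data.Bool.Base using (Bool; true; false; if_then_else_; _∧_; not)
import Data.Bool.Properties as Bool
open import Data.Fin.Base using (Fin; zero; suc; punchIn; toℕ; fromℕ<)
open import Data.Fin.Permutation
  using (Permutation′; _⟨$⟩ʳ_; _⟨$⟩ˡ_; insert; insert-punchIn; inverseˡ; inverseʳ)
import Data.Fin.Properties as Fin
open import Data.Fin.Subset
  using (Subset; inside; outside; ⊤; ⊥; ⁅_⁆; _∪_; _∩_; _-_; ∣_∣; _∈_; _∉_; _⊆_)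
open import Data.Fin.Subset.Induction using (⊂-wellFounded)
open import Data.Fin.Subset.Properties
  using (_∈?_; nonempty?; Empty-unique; ∣p∣≤n; ∣⊥∣≡0; ∈⊤; ⊆⊤; ⊆-antisym; x∈⁅x⁆; x∈⁅y⁆⇒x≡y; ∪-identityʳ;
         x∈p∩q⁺; p⊆p∪q; q⊆p∪q; x∈p∪q⁺; x∈p∪q⁻; p─q⊆p; x∈p∧x≢y⇒x∈p-y; x∈p⇒p-x⊂p)
open import Data.List.Base
  using (List; []; _∷_; _++_; map; filter; length; foldr; cartesianProductWith; tabulate; allFin)
import Data.List.Membership.Propositional as List
open import Data.List.Membership.Propositional.Properties using (∈-∃++; ∈-map⁻; ∈-filter⁻)
open import Data.List.Relation.Unary.Any using (here; there)
open import Data.Nat.Base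
open import Data.Nat.Induction using (<-wellFounded)
open import Data.Nat.ListAction using (sum)
open import Data.Nat.Properties
open import Data.Nat.Tactic.RingSolver using (solve-∀)
open import Data.Product.Base using (∃; _×_; _,_; proj₁; proj₂)
import Data.Product.Properties as Product
open import Data.Sum.Base using (inj₁; inj₂; [_,_]′)
open import Data.Vec.Base as Vec using (Vec; []; _∷_)
open import Data.Vec.Properties using (≡-dec)
open import Function.Base using (_∘_; id)
open import Function.Bundles using (mk⇔)
open import Induction.WellFounded using (Acc; acc)
open import Level using (Level)
open import Relation.Binary.Definitions using (DecidableEquality)
open import Relation.Binary.PropositionalEquality hiding ([_])
open import Relation.Nullary
open import Relation.Nullary.Decidable using (decidable-stable; does-⇔; dec-true; dec-false)
open import Relation.Unary using (Decidable)
open import Algebra.Properties.CommutativeMonoid.Sum +-0-commutativeMonoid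
  using (sum-cong-≗; sum-remove; ∑-distrib-+; sum-permute; sum-replicate-zero)
  renaming (sum to ∑ᶠ)

-- A rank sequence shows the size and the rank of an initial segment, but not whether that segment
-- is a flat: elements of its closure may come anywhere later. So all sets of size `s` and rank `k`
-- are counted, and the loop count `l` is carried along in order to recognise the flats at the end.
-- Likewise a sequence yields only lower bounds for `c` and `l`, since a coloop of `M|X` may stand
-- early in `X` and a loop of `M/X` late in the ordering; hence the system is triangular and not
-- diagonal. If `(c , l)` differs from `(j , m)` and `c + l ≤ j + m`, then `c < j` or `l < m`, so
-- the sum of the two counts can serve as the order of elimination. In the elimination common terms
-- are cancelled and never subtracted, which keeps it in `ℕ`.

private
  variable
    A B : Set
    P Q : Set
    n : ℕ

-- Finite sums and multiplicities

χ : Dec P → ℕ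
χ P? = if does P? then 1 else 0

χ-true : (P? : Dec P) → P → χ P? ≡ 1
χ-true P? p = cong (if_then 1 else 0) (dec-true P? p)

χ-false : (P? : Dec P) → ¬ P → χ P? ≡ 0
χ-false P? ¬p = cong (if_then 1 else 0) (dec-false P? ¬p)

χ≢0 : (P? : Dec P) → χ P? ≢ 0 → P
χ≢0 (yes p) _   = p
χ≢0 (no ¬p) ≢0 = contradiction refl ≢0

χ-⇔ : (P? : Dec P) (Q? : Dec Q) → (P → Q) → (Q → P) → χ P? ≡ χ Q?
χ-⇔ P? Q? f g = cong (if_then 1 else 0) (does-⇔ (mk⇔ f g) P? Q?)

χ-× : (P? : Dec P) (Q? : Dec Q) → χ (P? ×-dec Q?) ≡ χ P? * χ Q?
χ-× (yes _) (yes _) = refl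
χ-× (yes _) (no _)  = refl
χ-× (no _)  Q?      = refl

∑ : List A → (A → ℕ) → ℕ
∑ xs f = sum (map f xs)

∑-cong : ∀ (xs : List A) {f g} → (∀ x → f x ≡ g x) → ∑ xs f ≡ ∑ xs g
∑-cong []       f≗g = refl
∑-cong (x ∷ xs) f≗g = cong₂ _+_ (f≗g x) (∑-cong xs f≗g)

∑-zero : ∀ (xs : List A) {f} → (∀ x → f x ≡ 0) → ∑ xs f ≡ 0
∑-zero []       f≗0 = refl
∑-zero (x ∷ xs) f≗0 = cong₂ _+_ (f≗0 x) (∑-zero xs f≗0)

∑-≢0 : ∀ (f : A → ℕ) xs {x} → x List.∈ xs → f x ≢ 0 → ∑ xs f ≢ 0
∑-≢0 f (x ∷ xs) (here refl) fx≢0 ≡0 = fx≢0 (m+n≡0⇒m≡0 (f x) ≡0)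
∑-≢0 f (x ∷ xs) (there x∈)  fx≢0 ≡0 = ∑-≢0 f xs x∈ fx≢0 (m+n≡0⇒n≡0 (f x) ≡0)

∑-++ : ∀ (xs ys : List A) f → ∑ (xs ++ ys) f ≡ ∑ xs f + ∑ ys f
∑-++ []       ys f = refl
∑-++ (x ∷ xs) ys f = trans (cong (f x +_) (∑-++ xs ys f)) (sym (+-assoc (f x) _ _))

∑-insert : ∀ (xs : List A) {x} ys f → ∑ (xs ++ x ∷ ys) f ≡ f x + ∑ (xs ++ ys) f
∑-insert []           ys f = refl
∑-insert (z ∷ xs) {x} ys f = trans (cong (f z +_) (∑-insert xs ys f)) (rearrange (f z) (f x) _)
  where
  rearrange : ∀ a b c → a + (b + c) ≡ b + (a + c)
  rearrange = solve-∀

∑-+ : ∀ (xs : List A) f g → ∑ xs (λ x → f x + g x) ≡ ∑ xs f + ∑ xs g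
∑-+ []       f g = refl
∑-+ (x ∷ xs) f g = trans (cong (f x + g x +_) (∑-+ xs f g)) (rearrange (f x) (g x) _ _)
  where
  rearrange : ∀ a b c d → a + b + (c + d) ≡ a + c + (b + d)
  rearrange = solve-∀

∑-*ʳ : ∀ (xs : List A) f m → ∑ xs (λ x → f x * m) ≡ ∑ xs f * m
∑-*ʳ []       f m = refl
∑-*ʳ (x ∷ xs) f m = trans (cong (f x * m +_) (∑-*ʳ xs f m)) (sym (*-distribʳ-+ m (f x) _))

∑-*ˡ : ∀ (xs : List A) m f → ∑ xs (λ x → m * f x) ≡ m * ∑ xs f
∑-*ˡ xs m f = trans (∑-cong xs (λ x → *-comm m (f x))) (trans (∑-*ʳ xs f m) (*-comm _ m))

∑-map : ∀ (h : A → B) xs f → ∑ (map h xs) f ≡ ∑ xs (f ∘ h)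
∑-map h []       f = refl
∑-map h (x ∷ xs) f = cong (f (h x) +_) (∑-map h xs f)

∑-swap : ∀ (xs : List A) (ys : List B) (f : A → B → ℕ) →
         ∑ xs (λ x → ∑ ys (f x)) ≡ ∑ ys (λ y → ∑ xs (λ x → f x y))
∑-swap []       ys f = sym (∑-zero ys (λ _ → refl))
∑-swap (x ∷ xs) ys f = trans (cong (∑ ys (f x) +_) (∑-swap xs ys f)) (sym (∑-+ ys (f x) _))

∑-cartesianProductWith : ∀ {C : Set} (h : A → B → C) xs ys f →
  ∑ (cartesianProductWith h xs ys) f ≡ ∑ xs (λ x → ∑ ys (λ y → f (h x y)))
∑-cartesianProductWith h []       ys f = refl
∑-cartesianProductWith h (x ∷ xs) ys f = trans (∑-++ (map (h x) ys) _ f)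
  (cong₂ _+_ (∑-map (h x) ys f) (∑-cartesianProductWith h xs ys f))

∑-tabulate : ∀ {n} (h : Fin n → A) f → ∑ (tabulate h) f ≡ ∑ᶠ (f ∘ h)
∑-tabulate {n = zero}  h f = refl
∑-tabulate {n = suc n} h f = cong (f (h zero) +_) (∑-tabulate (h ∘ suc) f)

∑-filter : ∀ {P : A → Set} (P? : Decidable P) xs f →
           ∑ (filter P? xs) f ≡ ∑ xs (λ x → χ (P? x) * f x)
∑-filter P? []       f = refl
∑-filter P? (x ∷ xs) f with does (P? x)
... | true  = cong₂ _+_ (sym (+-identityʳ (f x))) (∑-filter P? xs f)
... | false = ∑-filter P? xs f

length-filter : ∀ {P : A → Set} (P? : Decidable P) xs → length (filter P? xs) ≡ ∑ xs (χ ∘ P?)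
length-filter P? []       = refl
length-filter P? (x ∷ xs) with does (P? x)
... | true  = cong suc (length-filter P? xs)
... | false = length-filter P? xs

module Multiplicity {A : Set} (_≟ᴬ_ : DecidableEquality A) where

  count : A → List A → ℕ
  count q xs = ∑ xs (λ x → χ (q ≟ᴬ x))

  ∑-select : ∀ q xs (f : A → ℕ) → ∑ xs (λ x → χ (q ≟ᴬ x) * f x) ≡ count q xs * f q
  ∑-select q xs f = trans (∑-cong xs pointwise) (∑-*ʳ xs (λ x → χ (q ≟ᴬ x)) (f q))
    where
    pointwise : ∀ x → χ (q ≟ᴬ x) * f x ≡ χ (q ≟ᴬ x) * f q
    pointwise x with q ≟ᴬ x
    ... | yes refl = refl
    ... | no _     = refl

  count≢0⇒∈ : ∀ q xs → count q xs ≢ 0 → q List.∈ xs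
  count≢0⇒∈ q []       ≢0 = contradiction refl ≢0
  count≢0⇒∈ q (x ∷ xs) ≢0 with q ≟ᴬ x
  ... | yes refl = here refl
  ... | no _     = there (count≢0⇒∈ q xs ≢0)

  ∑-absent : ∀ f ys → (∀ q → f q ≢ 0 → count q ys ≡ 0) → ∑ ys f ≡ 0
  ∑-absent f []       h = refl
  ∑-absent f (y ∷ ys) h = cong₂ _+_ fy≡0
    (∑-absent f ys λ q fq≢0 → m+n≡0⇒n≡0 (χ (q ≟ᴬ y)) (h q fq≢0))
    where
    fy≡0 : f y ≡ 0
    fy≡0 = decidable-stable (f y ≟ 0) λ fy≢0 → contradiction
      (trans (sym (χ-true (y ≟ᴬ y) refl)) (m+n≡0⇒m≡0 (χ (y ≟ᴬ y)) (h y fy≢0))) λ ()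

  -- Multiplicities are compared only where `f` is nonzero, so that the triangular induction can
  -- apply this knowing them for the heavier elements alone. An entry of `xs` with nonzero value
  -- also occurs in `ys` and is removed from both; an entry with value 0 is simply dropped.
  ∑-determined : ∀ f xs ys → (∀ q → f q ≢ 0 → count q xs ≡ count q ys) → ∑ xs f ≡ ∑ ys f
  ∑-determined f [] ys h = sym (∑-absent f ys λ q fq≢0 → sym (h q fq≢0))
  ∑-determined f (x ∷ xs) ys h = step (f x ≟ 0)
    where
    step : Dec (f x ≡ 0) → f x + ∑ xs f ≡ ∑ ys f
    step (yes fx≡0) = trans (cong (_+ ∑ xs f) fx≡0) (∑-determined f xs ys λ q fq≢0 → trans
      (cong (_+ count q xs) (sym (χ-false (q ≟ᴬ x) λ { refl → fq≢0 fx≡0 }))) (h q fq≢0))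
    step (no fx≢0) with ∈-∃++ (count≢0⇒∈ x ys λ ≡0 → contradiction
      (trans (sym (χ-true (x ≟ᴬ x) refl)) (m+n≡0⇒m≡0 _ (trans (h x fx≢0) ≡0))) λ ())
    ... | as , bs , refl = trans
      (cong (f x +_) (∑-determined f xs (as ++ bs) λ q fq≢0 →
        +-cancelˡ-≡ (χ (q ≟ᴬ x)) _ _ (trans (h q fq≢0) (∑-insert as bs _))))
      (sym (∑-insert as bs f))

  -- Downward induction on the weight: besides q itself, only elements heavier than q
  -- contribute to the sum of the kernel at q, and they do so equally on both sides.
  module Triangular
    (Good : A → Set) (weight : A → ℕ) (kernel : A → A → ℕ) (bound : ℕ)
    (weight≤bound : ∀ {q} → Good q → weight q ≤ bound)
    (diagonal : ∀ {q} → Good q → kernel q q ≢ 0)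
    (off-diagonal : ∀ {p q} → Good q → p ≢ q → weight p ≤ weight q → kernel p q ≡ 0)
    where

    ∑-kernel : ∀ {q} → Good q → ∀ xs → ∑ xs (λ x → kernel x q) ≡
      count q xs * kernel q q + ∑ xs (λ x → χ (weight q <? weight x) * kernel x q)
    ∑-kernel {q} good xs = trans (∑-cong xs pointwise)
      (trans (∑-+ xs _ _) (cong (_+ ∑ xs heavier) (∑-*ʳ xs (λ x → χ (q ≟ᴬ x)) (kernel q q))))
      where
      heavier : A → ℕ
      heavier x = χ (weight q <? weight x) * kernel x q
      pointwise : ∀ x → kernel x q ≡ χ (q ≟ᴬ x) * kernel q q + heavier x
      pointwise x with q ≟ᴬ x
      pointwise x | yes refl = sym (trans (cong₂ _+_ (+-identityʳ _)
        (cong (_* kernel q q) (χ-false (weight q <? weight q) (<-irrefl refl)))) (+-identityʳ _))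
      pointwise x | no q≢x = split (weight q <? weight x)
        where
        split : Dec (weight q < weight x) → kernel x q ≡ heavier x
        split (yes q<x) = sym (trans (cong (_* kernel x q) (χ-true (weight q <? weight x) q<x)) (*-identityˡ _))
        split (no q≮x)  = trans (off-diagonal good (q≢x ∘ sym) (≮⇒≥ q≮x))
          (sym (cong (_* kernel x q) (χ-false (weight q <? weight x) q≮x)))

    module _ (xs ys : List A)
      (xs-good : ∀ {q} → q List.∈ xs → Good q) (ys-good : ∀ {q} → q List.∈ ys → Good q)
      (sums≡ : ∀ {q} → Good q → ∑ xs (λ x → kernel x q) ≡ ∑ ys (λ y → kernel y q))
      where

      -- A nonzero multiplicity in either list supplies the proof of `Good q`; if both are zero they
      -- agree anyway. No decision procedure for `Good` is involved.
      counts≡-if-good : ∀ q → (Good q → count q xs ≡ count q ys) → count q xs ≡ count q ys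
      counts≡-if-good q eq with count q xs ≟ 0 | count q ys ≟ 0
      ... | yes x≡0 | yes y≡0 = trans x≡0 (sym y≡0)
      ... | no x≢0  | _       = eq (xs-good (count≢0⇒∈ q xs x≢0))
      ... | _       | no y≢0  = eq (ys-good (count≢0⇒∈ q ys y≢0))

      counts≡-acc : ∀ q → Acc _<_ (bound ∸ weight q) → count q xs ≡ count q ys
      counts≡-acc q (acc rec) = counts≡-if-good q λ good →
        *-cancelʳ-≡ _ _ (kernel q q) {{≢-nonZero (diagonal good)}}
          (+-cancelʳ-≡ (∑ xs heavier) _ _ (begin
            count q xs * kernel q q + ∑ xs heavier ≡⟨ ∑-kernel good xs ⟨
            ∑ xs (λ x → kernel x q)                ≡⟨ sums≡ good ⟩
            ∑ ys (λ y → kernel y q)                ≡⟨ ∑-kernel good ys ⟩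
            count q ys * kernel q q + ∑ ys heavier ≡⟨ cong (count q ys * kernel q q +_) heavier≡ ⟨
            count q ys * kernel q q + ∑ xs heavier ∎))
        where
        open ≡-Reasoning
        heavier : A → ℕ
        heavier x = χ (weight q <? weight x) * kernel x q
        heavier≡ : ∑ xs heavier ≡ ∑ ys heavier
        -- A nonzero value at `p` forces `weight p` above `weight q`, and a good `p` is within the
        -- bound, so `bound ∸ weight` strictly decreases.
        heavier≡ = ∑-determined heavier xs ys λ p ≢0 → counts≡-if-good p λ good →
          counts≡-acc p (rec (∸-monoʳ-<
            (χ≢0 (weight q <? weight p) λ ≡0 → ≢0 (cong (_* kernel p q) ≡0))
            (weight≤bound good)))

      counts≡ : ∀ q → count q xs ≡ count q ys
      counts≡ q = counts≡-acc q (<-wellFounded _)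

-- Counting coloured arrangements

-- The colour (x , y) of an element e relative to a set X records whether e ∈ X and
-- whether e is special: a coloop of M|X if e ∈ X, a loop of M/X otherwise.
Colour : Set
Colour = Bool × Bool

_≟ᶜ_ : DecidableEquality Colour
_≟ᶜ_ = Product.≡-dec Bool._≟_ Bool._≟_

private
  module Colours = Multiplicity _≟ᶜ_

colours : List Colour
colours = (true , true) ∷ (true , false) ∷ (false , true) ∷ (false , false) ∷ []

count-colours : ∀ a → Colours.count a colours ≡ 1
count-colours (true  , true)  = refl
count-colours (true  , false) = refl
count-colours (false , true)  = refl
count-colours (false , false) = refl

-- The second condition is one-sided: an ordinary position may also hold a special element. It thus
-- asks for no more than a rank sequence reveals.
Accepts : Colour → Colour → Set
Accepts (x , y) (x′ , y′) = x ≡ x′ × (y ≡ true → y′ ≡ true)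

accepts? : ∀ a b → Dec (Accepts a b)
accepts? (x , y) (x′ , y′) = x Bool.≟ x′ ×-dec (y Bool.≟ true →-dec y′ Bool.≟ true)

Arrangement : (Fin n → Colour) → (Fin n → Colour) → Permutation′ n → Set
Arrangement word colour π = ∀ i → Accepts (word i) (colour (π ⟨$⟩ʳ i))

arrangement? : (word colour : Fin n → Colour) → Decidable (Arrangement word colour)
arrangement? word colour π = Fin.all? λ i → accepts? (word i) (colour (π ⟨$⟩ʳ i))

tally : (Fin n → Colour) → Colour → ℕ
tally colour a = ∑ᶠ λ e → χ (colour e ≟ᶜ a)

_⊖_ : (Colour → ℕ) → Colour → Colour → ℕ
(t ⊖ b) a = t a ∸ χ (b ≟ᶜ a)

-- Recursion on the first letter: the element placed there has some colour `b` and can be chosen in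
-- `t b` ways. The truncation in `t ⊖ b` does no harm, because the factor `t b` is 0 whenever it
-- takes effect.
arrangements : (Fin n → Colour) → (Colour → ℕ) → ℕ
arrangements {zero}  word t = 1
arrangements {suc n} word t = ∑ colours λ b →
  t b * (χ (accepts? (word zero) b) * arrangements (word ∘ suc) (t ⊖ b))

arrangements-cong : ∀ (word : Fin n → Colour) {t t′} → (∀ a → t a ≡ t′ a) →
                    arrangements word t ≡ arrangements word t′
arrangements-cong {zero}  word t≗t′ = refl
arrangements-cong {suc n} word t≗t′ = ∑-cong colours λ b →
  cong₂ _*_ (t≗t′ b) (cong (χ (accepts? (word zero) b) *_)
    (arrangements-cong (word ∘ suc) λ a → cong (_∸ χ (b ≟ᶜ a)) (t≗t′ a)))

∑ᶠ-by-colour : ∀ (colour : Fin n → Colour) φ →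
               ∑ᶠ (φ ∘ colour) ≡ ∑ colours (λ b → tally colour b * φ b)
∑ᶠ-by-colour {zero}  colour φ = refl
∑ᶠ-by-colour {suc n} colour φ = begin
  φ c + ∑ᶠ (φ ∘ colour′)
    ≡⟨ cong₂ _+_ (sym φ-c) (∑ᶠ-by-colour colour′ φ) ⟩
  ∑ colours (λ b → χ (c ≟ᶜ b) * φ b) + ∑ colours (λ b → tally colour′ b * φ b)
    ≡⟨ ∑-+ colours (λ b → χ (c ≟ᶜ b) * φ b) (λ b → tally colour′ b * φ b) ⟨
  ∑ colours (λ b → χ (c ≟ᶜ b) * φ b + tally colour′ b * φ b)
    ≡⟨ ∑-cong colours (λ b → sym (*-distribʳ-+ (φ b) (χ (c ≟ᶜ b)) (tally colour′ b))) ⟩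
  ∑ colours (λ b → tally colour b * φ b) ∎
  where
  open ≡-Reasoning
  c = colour zero
  colour′ = colour ∘ suc
  φ-c : ∑ colours (λ b → χ (c ≟ᶜ b) * φ b) ≡ φ c
  φ-c = trans (Colours.∑-select c colours φ) (trans (cong (_* φ c) (count-colours c)) (*-identityˡ (φ c)))

tally-punchIn : ∀ (colour : Fin (suc n) → Colour) e a →
                tally (colour ∘ punchIn e) a ≡ (tally colour ⊖ colour e) a
tally-punchIn colour e a = sym (trans
  (cong (_∸ χ (colour e ≟ᶜ a)) (sum-remove {i = e} λ i → χ (colour i ≟ᶜ a)))
  (m+n∸m≡n (χ (colour e ≟ᶜ a)) _))

-- `permutations` picks the image `e` of the first position and arranges the others through
-- `punchIn e`. Removing `e` lowers the tally of its colour by one, and grouping the choices of `e`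
-- by colour gives the recursion of `arrangements`.
count-arrangements : ∀ (word colour : Fin n → Colour) →
  ∑ (permutations n) (χ ∘ arrangement? word colour) ≡ arrangements word (tally colour)
count-arrangements {zero}  word colour = refl
count-arrangements {suc n} word colour = begin
  ∑ (permutations (suc n)) (χ ∘ arrangement? word colour)
    ≡⟨ ∑-cartesianProductWith (insert zero) (allFin (suc n)) (permutations n) _ ⟩
  ∑ (allFin (suc n)) (λ e → ∑ (permutations n) λ ρ → χ (arrangement? word colour (insert zero e ρ)))
    ≡⟨ ∑-cong (allFin (suc n)) (λ e → ∑-cong (permutations n) (split e)) ⟩
  ∑ (allFin (suc n)) (λ e → ∑ (permutations n) λ ρ →
    χ (accepts? w (colour e)) * χ (arrangement? word′ (colour ∘ punchIn e) ρ))
    ≡⟨ ∑-cong (allFin (suc n)) (λ e → ∑-*ˡ (permutations n) (χ (accepts? w (colour e))) _) ⟩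
  ∑ (allFin (suc n)) (λ e →
    χ (accepts? w (colour e)) * ∑ (permutations n) (χ ∘ arrangement? word′ (colour ∘ punchIn e)))
    ≡⟨ ∑-cong (allFin (suc n)) (λ e → cong (χ (accepts? w (colour e)) *_)
         (trans (count-arrangements word′ (colour ∘ punchIn e))
                (arrangements-cong word′ (tally-punchIn colour e)))) ⟩
  ∑ (allFin (suc n)) (φ ∘ colour)
    ≡⟨ ∑-tabulate {n = suc n} id (φ ∘ colour) ⟩
  ∑ᶠ (φ ∘ colour)
    ≡⟨ ∑ᶠ-by-colour colour φ ⟩
  arrangements word (tally colour) ∎
  where
  open ≡-Reasoning
  w = word zero
  word′ = word ∘ suc
  φ : Colour → ℕ
  φ b = χ (accepts? w b) * arrangements word′ (tally colour ⊖ b)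
  split : ∀ e ρ → χ (arrangement? word colour (insert zero e ρ)) ≡
          χ (accepts? w (colour e)) * χ (arrangement? word′ (colour ∘ punchIn e) ρ)
  split e ρ = trans
    (χ-⇔ (arrangement? word colour (insert zero e ρ))
         (accepts? w (colour e) ×-dec arrangement? word′ (colour ∘ punchIn e) ρ)
      (λ arr → arr zero , λ i → subst (Accepts (word′ i) ∘ colour) (insert-punchIn zero e ρ i) (arr (suc i)))
      (λ { (acc₀ , arr) zero → acc₀
         ; (acc₀ , arr) (suc i) → subst (Accepts (word′ i) ∘ colour) (sym (insert-punchIn zero e ρ i)) (arr i) }))
    (χ-× (accepts? w (colour e)) (arrangement? word′ (colour ∘ punchIn e) ρ))

special-accepts-itself : ∀ {x b} → Accepts (x , true) b → b ≡ (x , true)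
special-accepts-itself (refl , special) = cong (_ ,_) (special refl)

-- Pigeonhole. A special letter accepts only its own colour, so each letter `(x , true)` uses up one
-- element of that colour. A shortage therefore survives every step with a nonzero term, and the
-- empty word admits no shortage.
arrangements-zero : ∀ (word : Fin n → Colour) t x →
  t (x , true) < tally word (x , true) → arrangements word t ≡ 0
arrangements-zero {suc n} word t x t<tally = ∑-zero colours {term} λ b → vanish b (t b ≟ 0) (accepts? w b)
  where
  w = word zero
  word′ = word ∘ suc
  a = (x , true)
  term : Colour → ℕ
  term b = t b * (χ (accepts? w b) * arrangements word′ (t ⊖ b))
  fewer : ∀ b → t b ≢ 0 → Accepts w b → Dec (w ≡ a) → (t ⊖ b) a < tally word′ a
  fewer b tb≢0 ok (yes w≡a) with refl ← special-accepts-itself {x} (subst (λ c → Accepts c b) w≡a ok) =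
    ≤-pred (begin-strict
      suc (t a ∸ χ (a ≟ᶜ a))       ≡⟨ cong (λ m → suc (t a ∸ m)) (χ-true (a ≟ᶜ a) refl) ⟩
      suc (t a ∸ 1)                ≡⟨ m+[n∸m]≡n (n≢0⇒n>0 tb≢0) ⟩
      t a                          <⟨ t<tally ⟩
      χ (w ≟ᶜ a) + tally word′ a   ≡⟨ cong (_+ tally word′ a) (χ-true (w ≟ᶜ a) w≡a) ⟩
      suc (tally word′ a)          ∎)
    where open ≤-Reasoning
  fewer b tb≢0 ok (no w≢a) = <-≤-trans (≤-<-trans (m∸n≤m (t a) (χ (b ≟ᶜ a))) t<tally)
    (≤-reflexive (cong (_+ tally word′ a) (χ-false (w ≟ᶜ a) w≢a)))
  vanish : ∀ b → Dec (t b ≡ 0) → Dec (Accepts w b) → term b ≡ 0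
  vanish b (yes tb≡0) _         = cong (_* (χ (accepts? w b) * arrangements word′ (t ⊖ b))) tb≡0
  vanish b (no _)     (no ¬ok) = trans
    (cong (λ m → t b * (m * arrangements word′ (t ⊖ b))) (χ-false (accepts? w b) ¬ok)) (*-zeroʳ (t b))
  vanish b (no tb≢0)  (yes ok) = trans
    (cong (λ m → t b * (χ (accepts? w b) * m))
      (arrangements-zero word′ (t ⊖ b) x (fewer b tb≢0 ok (w ≟ᶜ a))))
    (trans (cong (t b *_) (*-zeroʳ (χ (accepts? w b)))) (*-zeroʳ (t b)))

-- Placing at each position an element of exactly the colour of its letter is possible and keeps the
-- tallies matched; this one term already makes the sum nonzero.
arrangements-≢0 : ∀ (word : Fin n → Colour) {t} → (∀ a → t a ≡ tally word a) → arrangements word t ≢ 0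
arrangements-≢0 {zero}  word t≗tally = λ ()
arrangements-≢0 {suc n} word {t} t≗tally = ∑-≢0 term colours
  (Colours.count≢0⇒∈ w colours λ ≡0 → contradiction (trans (sym (count-colours w)) ≡0) λ ())
  (≢-nonZero⁻¹ (term w) {{m*n≢0 (t w) _ {{≢-nonZero t≢0}}
    {{m*n≢0 (χ (accepts? w w)) _ {{≢-nonZero χ≢0′}} {{≢-nonZero rest≢0}}}}}})
  where
  w = word zero
  term : Colour → ℕ
  term b = t b * (χ (accepts? w b) * arrangements (word ∘ suc) (t ⊖ b))
  t≢0 : t w ≢ 0
  t≢0 tw≡0 = contradiction (trans (sym (χ-true (w ≟ᶜ w) refl))
    (m+n≡0⇒m≡0 _ (trans (sym (t≗tally w)) tw≡0))) λ ()
  χ≢0′ : χ (accepts? w w) ≢ 0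
  χ≢0′ ≡0 = contradiction (trans (sym (χ-true (accepts? w w) (refl , id))) ≡0) λ ()
  rest≢0 : arrangements (word ∘ suc) (t ⊖ w) ≢ 0
  rest≢0 = arrangements-≢0 (word ∘ suc) λ a →
    trans (cong (_∸ χ (w ≟ᶜ a)) (t≗tally a)) (m+n∸m≡n (χ (w ≟ᶜ a)) _)

-- Positions below a + j lie in X; the special ones are a, …, a + j + m − 1.
phase : (a j m : ℕ) → ℕ → Colour
phase a j m i = (i <ᵇ a + j) , (not (i <ᵇ a) ∧ (i <ᵇ a + (j + m)))

-- Serves both as the tally of a `phase` word and as the tally of the colouring of a set, so that
-- the two are compared through the same four numbers.
profile : (a j m d : ℕ) → Colour → ℕ
profile a j m d (true  , true)  = j
profile a j m d (true  , false) = a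
profile a j m d (false , true)  = m
profile a j m d (false , false) = d

-- The length is written as the sum of the four stretches, so that peeling off the first position
-- lowers one summand and leaves, by computation, another `phase` word.
tally-phase : ∀ a j m d b → tally {a + (j + (m + d))} (phase a j m ∘ toℕ) b ≡ profile a j m d b
tally-phase (suc a) j m d b = trans (cong (χ ((true , false) ≟ᶜ b) +_) (tally-phase a j m d b)) (step b)
  where
  step : ∀ b → χ ((true , false) ≟ᶜ b) + profile a j m d b ≡ profile (suc a) j m d b
  step (true  , true)  = refl
  step (true  , false) = refl
  step (false , true)  = refl
  step (false , false) = refl
tally-phase zero (suc j) m d b =
  trans (cong (χ ((true , true) ≟ᶜ b) +_) (tally-phase zero j m d b)) (step b)
  where
  step : ∀ b → χ ((true , true) ≟ᶜ b) + profile 0 j m d b ≡ profile 0 (suc j) m d b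
  step (true  , true)  = refl
  step (true  , false) = refl
  step (false , true)  = refl
  step (false , false) = refl
tally-phase zero zero (suc m) d b =
  trans (cong (χ ((false , true) ≟ᶜ b) +_) (tally-phase zero zero m d b)) (step b)
  where
  step : ∀ b → χ ((false , true) ≟ᶜ b) + profile 0 0 m d b ≡ profile 0 0 (suc m) d b
  step (true  , true)  = refl
  step (true  , false) = refl
  step (false , true)  = refl
  step (false , false) = refl
tally-phase zero zero zero (suc d) b =
  trans (cong (χ ((false , false) ≟ᶜ b) +_) (tally-phase zero zero zero d b)) (step b)
  where
  step : ∀ b → χ ((false , false) ≟ᶜ b) + profile 0 0 0 d b ≡ profile 0 0 0 (suc d) b
  step (true  , true)  = refl
  step (true  , false) = refl
  step (false , true)  = refl
  step (false , false) = refl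
tally-phase zero zero zero zero (true  , true)  = refl
tally-phase zero zero zero zero (true  , false) = refl
tally-phase zero zero zero zero (false , true)  = refl
tally-phase zero zero zero zero (false , false) = refl

-- Rank along an ordering

does-true : {P : Set} (P? : Dec P) → does P? ≡ true → P
does-true (yes p) _ = p

∣p∪⁅x⁆∣≤1+∣p∣ : ∀ (p : Subset n) x → ∣ p ∪ ⁅ x ⁆ ∣ ≤ suc ∣ p ∣
∣p∪⁅x⁆∣≤1+∣p∣ (s ∷ p)       (suc x) with s
... | inside  = s≤s (∣p∪⁅x⁆∣≤1+∣p∣ p x)
... | outside = ∣p∪⁅x⁆∣≤1+∣p∣ p x
∣p∪⁅x⁆∣≤1+∣p∣ (s ∷ p) zero rewrite ∪-identityʳ p with s
... | inside  = n≤1+n _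
... | outside = ≤-refl

x∉p-x : ∀ (p : Subset n) x → x ∉ p - x
x∉p-x (s ∷ p) (suc x) (Vec.there x∈) = x∉p-x p x x∈

x∈p-y⇒x≢y : ∀ {p : Subset n} {x y} → x ∈ p - y → x ≢ y
x∈p-y⇒x≢y {p = p} {x} x∈p-y refl = x∉p-x p x x∈p-y

p⊆p-x∪⁅x⁆ : ∀ (p : Subset n) x → p ⊆ (p - x) ∪ ⁅ x ⁆
p⊆p-x∪⁅x⁆ p x {y} y∈p with y Fin.≟ x
... | yes refl = x∈p∪q⁺ {p = p - x} (inj₂ (x∈⁅x⁆ x))
... | no y≢x   = x∈p∪q⁺ (inj₁ (x∈p∧x≢y⇒x∈p-y y∈p y≢x))

∪-⊆ : ∀ {p q r : Subset n} → p ⊆ r → q ⊆ r → p ∪ q ⊆ r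
∪-⊆ {p = p} {q} p⊆r q⊆r = [ p⊆r , q⊆r ]′ ∘ x∈p∪q⁻ p q

⁅x⁆⊆ : ∀ {p : Subset n} {x} → x ∈ p → ⁅ x ⁆ ⊆ p
⁅x⁆⊆ {x = x} x∈p y∈ with refl ← x∈⁅y⁆⇒x≡y x y∈ = x∈p

-- For ρ the ranks of the prefixes of an ordering: the first a + j elements have rank k, the
-- last j of them are coloops of their restriction, and the next m are loops of the contraction.
Chain : (a j m k : ℕ) → (ℕ → ℕ) → Set
Chain a j m k ρ = ρ (a + j) ≡ k × ρ a + j ≤ k × ρ (a + (j + m)) ≤ k

chain? : ∀ a j m k → Decidable (Chain a j m k)
chain? a j m k ρ = ρ (a + j) ≟ k ×-dec ρ a + j ≤? k ×-dec ρ (a + (j + m)) ≤? k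

module _ (M : Matroid (⊤ {n})) where

  private
    r : Subset n → ℕ
    r = rank M

  rank-⊆ : ∀ {X Y} → X ⊆ Y → r X ≤ r Y
  rank-⊆ X⊆Y = rank-mono M X⊆Y ⊆⊤

  rank-submodular-⊆ : ∀ {X Y U V} → U ⊆ X ∪ Y → V ⊆ X ∩ Y → r U + r V ≤ r X + r Y
  rank-submodular-⊆ U⊆ V⊆ = ≤-trans (+-mono-≤ (rank-⊆ U⊆) (rank-⊆ V⊆)) (rank-submodular M ⊆⊤ ⊆⊤)

  -- `IsColoop` speaks of bases, while everything else is in terms of rank; this is the bridge. The
  -- basis is grown greedily, one element of `Y` at a time.
  basis-exists : ∀ Y → ∃ λ B → B ⊆ Y × r B ≡ ∣ B ∣ × r B ≡ r Y
  basis-exists Y = go Y (⊂-wellFounded Y)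
    where
    go : ∀ Y → Acc _ Y → ∃ λ B → B ⊆ Y × r B ≡ ∣ B ∣ × r B ≡ r Y
    go Y (acc rec) with nonempty? Y
    ... | no empty with refl ← Empty-unique empty =
      ⊥ , id , trans (rank-⊥ M id) (sym (∣⊥∣≡0 n)) , refl
    ... | yes (e , e∈Y) with go (Y - e) (rec (x∈p⇒p-x⊂p e∈Y))
    ...   | B , B⊆Y-e , indep , spans with r B <? r (B ∪ ⁅ e ⁆)
    ...     | yes rB<rBe = B ∪ ⁅ e ⁆ , Be⊆Y , Be-indep , Be-spans
      where
      B⊆Y : B ⊆ Y
      B⊆Y = p─q⊆p Y ⁅ e ⁆ ∘ B⊆Y-e
      Be⊆Y : B ∪ ⁅ e ⁆ ⊆ Y
      Be⊆Y = ∪-⊆ B⊆Y (⁅x⁆⊆ e∈Y)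
      Be-indep : r (B ∪ ⁅ e ⁆) ≡ ∣ B ∪ ⁅ e ⁆ ∣
      Be-indep = ≤-antisym (rank≤∣∣ M ⊆⊤) (≤-trans (∣p∪⁅x⁆∣≤1+∣p∣ B e)
        (≤-trans (s≤s (≤-reflexive (sym indep))) rB<rBe))
      Be-spans : r (B ∪ ⁅ e ⁆) ≡ r Y
      Be-spans = ≤-antisym (rank-⊆ Be⊆Y) (begin
        r Y                   ≤⟨ rank-⊆ (p⊆p-x∪⁅x⁆ Y e) ⟩
        r ((Y - e) ∪ ⁅ e ⁆)   ≤⟨ rank-∪⁅⁆ M (Y - e) e ⟩
        suc (r (Y - e))       ≡⟨ cong suc spans ⟨
        suc (r B)             ≤⟨ rB<rBe ⟩
        r (B ∪ ⁅ e ⁆)         ∎)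
        where open ≤-Reasoning
    -- Submodularity for `Y - e` and `B ∪ ⁅ e ⁆`, whose union contains `Y` and whose intersection
    -- contains `B`, shows that `e` adds nothing to the rank of `Y - e` either.
    ...     | no rB≮rBe = B , B⊆Y , indep , ≤-antisym (rank-⊆ B⊆Y)
      (+-cancelʳ-≤ (r B) _ _ (begin
        r Y + r B                 ≤⟨ rank-submodular-⊆ Y⊆ B⊆ ⟩
        r (Y - e) + r (B ∪ ⁅ e ⁆) ≤⟨ +-mono-≤ (≤-reflexive (sym spans)) (≮⇒≥ rB≮rBe) ⟩
        r B + r B                 ∎))
      where
      open ≤-Reasoning
      B⊆Y : B ⊆ Y
      B⊆Y = p─q⊆p Y ⁅ e ⁆ ∘ B⊆Y-e
      Y⊆ : Y ⊆ (Y - e) ∪ (B ∪ ⁅ e ⁆)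
      Y⊆ y∈ = x∈p∪q⁺ ([ inj₁ , inj₂ ∘ q⊆p∪q B ⁅ e ⁆ ]′ (x∈p∪q⁻ (Y - e) ⁅ e ⁆ (p⊆p-x∪⁅x⁆ Y e y∈)))
      B⊆ : B ⊆ (Y - e) ∩ (B ∪ ⁅ e ⁆)
      B⊆ b∈ = x∈p∩q⁺ (B⊆Y-e b∈ , p⊆p∪q ⁅ e ⁆ b∈)

  module _ {X : Subset n} {e : Fin n} where

    -- If the rank did not drop, a basis of `X - e` would be a basis of `M|X` that avoids `e`.
    coloop⇒rank-drops : IsColoop (restrict M X ⊆⊤) e → r (X - e) < r X
    coloop⇒rank-drops (e∈X , in-bases) = ≰⇒> λ rX≤ →
      let B , B⊆ , indep , spans = basis-exists (X - e)
          B⊆X : B ⊆ X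
          B⊆X = p─q⊆p X ⁅ e ⁆ ∘ B⊆
      in x∉p-x X e (B⊆ (in-bases B (B⊆X , indep ,
           ≤-antisym (rank-⊆ B⊆X) (≤-trans rX≤ (≤-reflexive (sym spans))))))

    -- A basis that avoids `e` lies in `X - e`, which would then have full rank in `X`.
    rank-drops⇒coloop : e ∈ X → r (X - e) < r X → IsColoop (restrict M X ⊆⊤) e
    rank-drops⇒coloop e∈X drops = e∈X , λ B (B⊆X , _ , spans) →
      decidable-stable (e ∈? B) λ e∉B → <⇒≱ drops (≤-trans (≤-reflexive (sym spans))
        (rank-⊆ λ b∈B → x∈p∧x≢y⇒x∈p-y (B⊆X b∈B) λ { refl → e∉B b∈B }))

  Special : Subset n → Fin n → Set
  Special X e = (e ∈ X → r (X - e) < r X) × (e ∉ X → r (X ∪ ⁅ e ⁆) ≤ r X)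

  special? : ∀ X → Decidable (Special X)
  special? X e = (e ∈? X →-dec r (X - e) <? r X) ×-dec (¬? (e ∈? X) →-dec r (X ∪ ⁅ e ⁆) ≤? r X)

  colouring : Subset n → Fin n → Colour
  colouring X e = does (e ∈? X) , does (special? X e)

  module _ (π : Permutation′ n) where

    private
      ρ : ℕ → ℕ
      ρ = r ∘ prefix π

    prefix-⊆ : ∀ {i j} → i ≤ j → prefix π i ⊆ prefix π j
    prefix-⊆ i≤j e∈ = ∈-prefix⁺ π (<-≤-trans (∈-prefix⁻ π e∈) i≤j)

    position : ∀ i → toℕ (π ⟨$⟩ˡ (π ⟨$⟩ʳ i)) ≡ toℕ i
    position i = cong toℕ (inverseˡ π)

    ∈-prefix-position⁺ : ∀ {i j} → toℕ i < j → π ⟨$⟩ʳ i ∈ prefix π j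
    ∈-prefix-position⁺ {i} i<j = ∈-prefix⁺ π (subst (_< _) (sym (position i)) i<j)

    ∈-prefix-position⁻ : ∀ {i j} → π ⟨$⟩ʳ i ∈ prefix π j → toℕ i < j
    ∈-prefix-position⁻ {i} πi∈ = subst (_< _) (position i) (∈-prefix⁻ π πi∈)

    -- Diminishing returns: the element raises the rank of `X - e`, hence also that of the smaller
    -- prefix before it. This is submodularity for the prefix ending in `e` and `X - e`.
    coloop-increments : ∀ {X} i → prefix π (suc (toℕ i)) ⊆ X → r (X - (π ⟨$⟩ʳ i)) < r X →
                        ρ (toℕ i) < ρ (suc (toℕ i))
    coloop-increments {X} i P⊆X drops = +-cancelˡ-< (r X) _ _ (begin-strict
      r X + ρ (toℕ i)             ≤⟨ rank-submodular-⊆ X⊆ P⊆ ⟩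
      ρ (suc (toℕ i)) + r (X - e) <⟨ +-monoʳ-< (ρ (suc (toℕ i))) drops ⟩
      ρ (suc (toℕ i)) + r X       ≡⟨ +-comm _ (r X) ⟩
      r X + ρ (suc (toℕ i))       ∎)
      where
      open ≤-Reasoning
      e = π ⟨$⟩ʳ i
      X⊆ : X ⊆ prefix π (suc (toℕ i)) ∪ (X - e)
      X⊆ {x} x∈X with x Fin.≟ e
      ... | yes refl = x∈p∪q⁺ (inj₁ (∈-prefix-position⁺ ≤-refl))
      ... | no x≢e   = x∈p∪q⁺ {p = prefix π (suc (toℕ i))} (inj₂ (x∈p∧x≢y⇒x∈p-y x∈X x≢e))
      P⊆ : prefix π (toℕ i) ⊆ prefix π (suc (toℕ i)) ∩ (X - e)
      P⊆ x∈P = x∈p∩q⁺ (x∈P′ , x∈p∧x≢y⇒x∈p-y (P⊆X x∈P′) λ { refl → <-irrefl refl (∈-prefix-position⁻ x∈P) })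
        where x∈P′ = prefix-mono π (toℕ i) x∈P

    -- Diminishing returns in the other direction: what adds nothing to `X` adds nothing to a larger
    -- prefix.
    loop-preserves : ∀ {X} i → X ⊆ prefix π (toℕ i) → r (X ∪ ⁅ π ⟨$⟩ʳ i ⁆) ≤ r X →
                     ρ (suc (toℕ i)) ≤ ρ (toℕ i)
    loop-preserves {X} i X⊆P loop = +-cancelʳ-≤ (r X) _ _ (≤-trans
      (rank-submodular-⊆ P⊆ λ x∈X → x∈p∩q⁺ (X⊆P x∈X , p⊆p∪q _ x∈X))
      (+-monoʳ-≤ (ρ (toℕ i)) loop))
      where
      P⊆ : prefix π (suc (toℕ i)) ⊆ prefix π (toℕ i) ∪ (X ∪ ⁅ π ⟨$⟩ʳ i ⁆)
      P⊆ x∈ = x∈p∪q⁺ ([ inj₁ , inj₂ ∘ q⊆p∪q X _ ]′ (x∈p∪q⁻ (prefix π (toℕ i)) _ (prefix-suc π i x∈)))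

    at-position : ∀ {P : ℕ → Set} → (∀ (i : Fin n) → P (toℕ i)) → ∀ {i} → i < n → P i
    at-position {P} all i<n = subst P (Fin.toℕ-fromℕ< i<n) (all (fromℕ< i<n))

    climb : ∀ (f : ℕ → ℕ) → (∀ (i : Fin n) → f (suc (toℕ i)) ≤ suc (f (toℕ i))) →
            ∀ p q → p + q ≤ n → f (p + q) ≤ q + f p
    climb f step p zero    _     = ≤-reflexive (cong f (+-identityʳ p))
    climb f step p (suc q) bound = subst (λ i → f i ≤ suc q + f p) (sym (+-suc p q))
      (≤-trans (at-position {λ i → f (suc i) ≤ suc (f i)} step p+q<n)
        (s≤s (climb f step p q (<⇒≤ p+q<n))))
      where
      p+q<n : p + q < n
      p+q<n = subst (_≤ n) (+-suc p q) bound

    -- After the first `a` elements, each remaining element of the prefix other than `e` adds at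
    -- most one, and there are `s ∸ a ∸ 1` of these. The summand `a` stands on the left to avoid
    -- truncated subtraction.
    rank-prefix-minus : ∀ {a s} i → a ≤ toℕ i → toℕ i < s → s ≤ n →
                        a + r (prefix π s - (π ⟨$⟩ʳ i)) < ρ a + s
    -- Between the first `a` elements and `e` there are `p` others; after `e` the prefix has `q`
    -- more.
    rank-prefix-minus {a} i a≤i i<s s≤n
      with p , refl′ ← m≤n⇒∃[o]m+o≡n a≤i | q , refl ← m≤n⇒∃[o]m+o≡n i<s = begin-strict
      a + ρ′ (suc (toℕ i) + q)       ≤⟨ +-monoʳ-≤ a (climb ρ′ ρ′-step (suc (toℕ i)) q s≤n) ⟩
      a + (q + ρ′ (suc (toℕ i)))     ≤⟨ +-monoʳ-≤ a (+-monoʳ-≤ q (rank-⊆ drop-e)) ⟩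
      a + (q + ρ (toℕ i))            ≡⟨ cong (λ t → a + (q + ρ t)) refl′ ⟨
      a + (q + ρ (a + p))            ≤⟨ +-monoʳ-≤ a (+-monoʳ-≤ q (climb ρ ρ-step a p
                                          (≤-trans (≤-reflexive refl′) (Fin.toℕ≤n i)))) ⟩
      a + (q + (p + ρ a))            <⟨ ≤-reflexive (rearrange a q p (ρ a)) ⟩
      ρ a + (suc (a + p) + q)        ≡⟨ cong (λ t → ρ a + (suc t + q)) refl′ ⟩
      ρ a + (suc (toℕ i) + q)        ∎
      where
      open ≤-Reasoning
      e = π ⟨$⟩ʳ i
      ρ′ : ℕ → ℕ
      ρ′ t = r (prefix π t - e)
      rearrange : ∀ a q p x → suc (a + (q + (p + x))) ≡ x + (suc (a + p) + q)
      rearrange = solve-∀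
      ρ-step : ∀ (i : Fin n) → ρ (suc (toℕ i)) ≤ suc (ρ (toℕ i))
      ρ-step i = ≤-trans (rank-⊆ (prefix-suc π i)) (rank-∪⁅⁆ M _ _)
      ρ′-step : ∀ (i : Fin n) → ρ′ (suc (toℕ i)) ≤ suc (ρ′ (toℕ i))
      ρ′-step i = ≤-trans (rank-⊆ λ x∈ → x∈p∪q⁺
        ([ (λ x∈P → inj₁ (x∈p∧x≢y⇒x∈p-y x∈P (x∈p-y⇒x≢y x∈))) , inj₂ ]′
          (x∈p∪q⁻ (prefix π (toℕ i)) _ (prefix-suc π i (p─q⊆p _ ⁅ e ⁆ x∈))))) (rank-∪⁅⁆ M _ _)
      drop-e : prefix π (suc (toℕ i)) - e ⊆ prefix π (toℕ i)
      drop-e x∈ = [ id , (λ x∈e → contradiction (x∈⁅y⁆⇒x≡y e x∈e) (x∈p-y⇒x≢y x∈)) ]′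
        (x∈p∪q⁻ (prefix π (toℕ i)) _ (prefix-suc π i (p─q⊆p _ ⁅ e ⁆ x∈)))

    module _ {X : Subset n} {a j m k : ℕ} (bound : a + (j + m) ≤ n) (rX≡k : r X ≡ k) where

      private
        s = a + j
        word : Fin n → Colour
        word = phase a j m ∘ toℕ
        s+m≡ : s + m ≡ a + (j + m)
        s+m≡ = +-assoc a j m
        s≤n : s ≤ n
        s≤n = ≤-trans (m≤m+n s m) (≤-trans (≤-reflexive s+m≡) bound)

        special-phase? : ∀ i → Dec (¬ i < a × i < a + (j + m))
        special-phase? i = ¬? (i <? a) ×-dec i <? a + (j + m)

      -- The last `j` elements of `X` raise the rank by at least `j` in total, so none can be
      -- spared: by `rank-prefix-minus`, omitting any one of them lowers the rank of `X`. Each of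
      -- the next `m` lies together with `X` in a prefix of rank at most `k`.
      chain⇒arrangement : prefix π s ≡ X → Chain a j m k ρ → Arrangement word (colouring X) π
      chain⇒arrangement refl (_ , ρa+j≤k , ρ≤k) i =
        does-⇔ (mk⇔ ∈-prefix-position⁺ ∈-prefix-position⁻) (toℕ i <? s) (e ∈? prefix π s) ,
        λ special → dec-true (special? (prefix π s) e) (special-e (does-true (special-phase? (toℕ i)) special))
        where
        e = π ⟨$⟩ʳ i
        special-e : ¬ toℕ i < a × toℕ i < a + (j + m) → Special (prefix π s) e
        special-e (i≮a , i<) = coloop , loop
          where
          open ≤-Reasoning
          rearrange : ∀ x a j → x + (a + j) ≡ a + (x + j)
          rearrange = solve-∀
          coloop : e ∈ prefix π s → r (prefix π s - e) < ρ s
          coloop e∈ = +-cancelˡ-< a _ _ (begin-strict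
            a + r (prefix π s - e) <⟨ rank-prefix-minus i (≮⇒≥ i≮a) (∈-prefix-position⁻ e∈) s≤n ⟩
            ρ a + s                ≡⟨ rearrange (ρ a) a j ⟩
            a + (ρ a + j)          ≤⟨ +-monoʳ-≤ a ρa+j≤k ⟩
            a + k                  ≡⟨ cong (a +_) rX≡k ⟨
            a + ρ s                ∎)
          loop : e ∉ prefix π s → r (prefix π s ∪ ⁅ e ⁆) ≤ ρ s
          loop _ = begin
            r (prefix π s ∪ ⁅ e ⁆) ≤⟨ rank-⊆ (∪-⊆ (prefix-⊆ (≤-trans (m≤m+n s m) (≤-reflexive s+m≡)))
                                         (⁅x⁆⊆ (∈-prefix-position⁺ i<))) ⟩
            ρ (a + (j + m))        ≤⟨ ρ≤k ⟩
            k                      ≡⟨ rX≡k ⟨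
            ρ s                    ∎

      arrangement⇒prefix : Arrangement word (colouring X) π → prefix π s ≡ X
      arrangement⇒prefix arr = ⊆-antisym
        (λ {x} x∈P → does-true (x ∈? X) (trans (sym (side x))
          (dec-true (toℕ (π ⟨$⟩ˡ x) <? s) (∈-prefix⁻ π x∈P))))
        (λ {x} x∈X → ∈-prefix⁺ π (does-true (toℕ (π ⟨$⟩ˡ x) <? s)
          (trans (side x) (dec-true (x ∈? X) x∈X))))
        where
        side : ∀ x → does (toℕ (π ⟨$⟩ˡ x) <? s) ≡ does (x ∈? X)
        side x = trans (proj₁ (arr (π ⟨$⟩ˡ x))) (cong (λ y → does (y ∈? X)) (inverseʳ π))

      -- The converse goes position by position: `up` accumulates the increments at the coloops,
      -- `flat` the absence of increments at the loops.
      arrangement⇒chain : Arrangement word (colouring X) π → Chain a j m k ρ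
      arrangement⇒chain arr = ρs≡k , ≤-trans (up j ≤-refl) (≤-reflexive ρs≡k) ,
        ≤-trans (≤-reflexive (cong ρ (sym s+m≡))) (≤-trans (flat m ≤-refl) (≤-reflexive ρs≡k))
        where
        P≡X : prefix π s ≡ X
        P≡X = arrangement⇒prefix arr
        ρs≡k : ρ s ≡ k
        ρs≡k = trans (cong r P≡X) rX≡k
        special : ∀ i → a ≤ toℕ i → toℕ i < a + (j + m) → Special X (π ⟨$⟩ʳ i)
        special i a≤i i< = does-true (special? X (π ⟨$⟩ʳ i))
          (proj₂ (arr i) (dec-true (special-phase? (toℕ i)) (≤⇒≯ a≤i , i<)))
        up-step : ∀ (i : Fin n) → a ≤ toℕ i → toℕ i < s → ρ (toℕ i) < ρ (suc (toℕ i))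
        up-step i a≤i i<s = coloop-increments i (subst (prefix π (suc (toℕ i)) ⊆_) P≡X (prefix-⊆ i<s))
          (proj₁ (special i a≤i (<-≤-trans i<s (≤-trans (m≤m+n s m) (≤-reflexive s+m≡))))
            (subst (π ⟨$⟩ʳ i ∈_) P≡X (∈-prefix-position⁺ i<s)))
        up : ∀ t → t ≤ j → ρ a + t ≤ ρ (a + t)
        up zero    _   = ≤-reflexive (trans (+-identityʳ (ρ a)) (cong ρ (sym (+-identityʳ a))))
        up (suc t) t<j = begin
          ρ a + suc t    ≡⟨ +-suc (ρ a) t ⟩
          suc (ρ a + t)  ≤⟨ s≤s (up t (<⇒≤ t<j)) ⟩
          suc (ρ (a + t)) ≤⟨ at-position {λ i → a ≤ i → i < s → ρ i < ρ (suc i)} up-step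
                              (<-≤-trans a+t<s s≤n) (m≤m+n a t) a+t<s ⟩
          ρ (suc (a + t)) ≡⟨ cong ρ (+-suc a t) ⟨
          ρ (a + suc t)  ∎
          where
          open ≤-Reasoning
          a+t<s : a + t < s
          a+t<s = +-monoʳ-< a t<j
        flat-step : ∀ (i : Fin n) → s ≤ toℕ i → toℕ i < s + m → ρ (suc (toℕ i)) ≤ ρ (toℕ i)
        flat-step i s≤i i< = loop-preserves i (subst (_⊆ prefix π (toℕ i)) P≡X (prefix-⊆ s≤i))
          (proj₂ (special i (≤-trans (m≤m+n a j) s≤i) (<-≤-trans i< (≤-reflexive s+m≡)))
            λ e∈X → <⇒≱ (∈-prefix-position⁻ (subst (π ⟨$⟩ʳ i ∈_) (sym P≡X) e∈X)) s≤i)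
        flat : ∀ t → t ≤ m → ρ (s + t) ≤ ρ s
        flat zero    _   = ≤-reflexive (cong ρ (+-identityʳ s))
        flat (suc t) t<m = begin
          ρ (s + suc t)   ≡⟨ cong ρ (+-suc s t) ⟩
          ρ (suc (s + t)) ≤⟨ at-position {λ i → s ≤ i → i < s + m → ρ (suc i) ≤ ρ i} flat-step
                              (<-≤-trans s+t< (≤-trans (≤-reflexive s+m≡) bound)) (m≤m+n s t) s+t< ⟩
          ρ (s + t)       ≤⟨ flat t (<⇒≤ t<m) ⟩
          ρ s             ∎
          where
          open ≤-Reasoning
          s+t< : s + t < s + m
          s+t< = +-monoʳ-< s t<m

-- The triangular system

_≟ˢ_ : DecidableEquality (Subset n)
_≟ˢ_ = ≡-dec Bool._≟_

private
  module Subsets {n} = Multiplicity (_≟ˢ_ {n})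

count-allSubsets : ∀ (X : Subset n) → Subsets.count X (allSubsets n) ≡ 1
count-allSubsets []      = refl
count-allSubsets {suc n} (x ∷ X) = begin
  Subsets.count (x ∷ X) (map (inside ∷_) all ++ map (outside ∷_) all)
    ≡⟨ ∑-++ (map (inside ∷_) all) _ _ ⟩
  Subsets.count (x ∷ X) (map (inside ∷_) all) + Subsets.count (x ∷ X) (map (outside ∷_) all)
    ≡⟨ cong₂ _+_ (extend inside) (extend outside) ⟩
  χ (x Bool.≟ inside) + χ (x Bool.≟ outside)
    ≡⟨ χ-Bool x ⟩
  1 ∎
  where
  open ≡-Reasoning
  all = allSubsets n
  χ-Bool : ∀ x → χ (x Bool.≟ inside) + χ (x Bool.≟ outside) ≡ 1
  χ-Bool true  = refl
  χ-Bool false = refl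
  extend : ∀ y → Subsets.count (x ∷ X) (map (y ∷_) all) ≡ χ (x Bool.≟ y)
  extend y = begin
    Subsets.count (x ∷ X) (map (y ∷_) all)
      ≡⟨ ∑-map (y ∷_) all _ ⟩
    ∑ all (λ Y → χ ((x ∷ X) ≟ˢ (y ∷ Y)))
      ≡⟨ ∑-cong all (λ Y → trans
           (χ-⇔ ((x ∷ X) ≟ˢ (y ∷ Y)) (x Bool.≟ y ×-dec X ≟ˢ Y)
             (λ { refl → refl , refl }) (λ { (refl , refl) → refl }))
           (χ-× (x Bool.≟ y) (X ≟ˢ Y))) ⟩
    ∑ all (λ Y → χ (x Bool.≟ y) * χ (X ≟ˢ Y))
      ≡⟨ ∑-*ˡ all (χ (x Bool.≟ y)) _ ⟩
    χ (x Bool.≟ y) * Subsets.count X all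
      ≡⟨ cong (χ (x Bool.≟ y) *_) (count-allSubsets X) ⟩
    χ (x Bool.≟ y) * 1
      ≡⟨ *-identityʳ _ ⟩
    χ (x Bool.≟ y) ∎

∣tabulate∣ : ∀ {P : Fin n → Set} (P? : Decidable P) → ∣ Vec.tabulate (does ∘ P?) ∣ ≡ ∑ᶠ (χ ∘ P?)
∣tabulate∣ {zero}  P? = refl
∣tabulate∣ {suc n} P? with does (P? zero)
... | true  = cong suc (∣tabulate∣ (P? ∘ suc))
... | false = ∣tabulate∣ (P? ∘ suc)

∣p∣≡∑ᶠ : ∀ (p : Subset n) → ∣ p ∣ ≡ ∑ᶠ λ x → χ (x ∈? p)
∣p∣≡∑ᶠ []            = refl
∣p∣≡∑ᶠ (inside  ∷ p) = cong suc (∣p∣≡∑ᶠ p)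
∣p∣≡∑ᶠ (outside ∷ p) = ∣p∣≡∑ᶠ p

∑ᶠ-zero : ∀ {f : Fin n → ℕ} → (∀ i → f i ≡ 0) → ∑ᶠ f ≡ 0
∑ᶠ-zero {n} f≗0 = trans (sum-cong-≗ f≗0) (sum-replicate-zero n)

∑ᶠ≡0 : ∀ (f : Fin n → ℕ) → ∑ᶠ f ≡ 0 → ∀ i → f i ≡ 0
∑ᶠ≡0 f ≡0 zero    = m+n≡0⇒m≡0 (f zero) ≡0
∑ᶠ≡0 f ≡0 (suc i) = ∑ᶠ≡0 (f ∘ suc) (m+n≡0⇒n≡0 (f zero) ≡0) i

∑ᶠ-one : ∀ n → ∑ᶠ {n} (λ _ → 1) ≡ n
∑ᶠ-one zero    = refl
∑ᶠ-one (suc n) = cong suc (∑ᶠ-one n)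

∑ᶠ-< : ∀ {n s} → s ≤ n → ∑ᶠ {n} (λ i → χ (toℕ i <? s)) ≡ s
∑ᶠ-< {n} z≤n       = ∑ᶠ-zero {n} λ _ → refl
∑ᶠ-< (s≤s s≤n) = cong suc (∑ᶠ-< s≤n)

∣prefix∣ : ∀ (π : Permutation′ n) {s} → s ≤ n → ∣ prefix π s ∣ ≡ s
∣prefix∣ {n} π {s} s≤n = begin
  ∣ prefix π s ∣                               ≡⟨ ∣tabulate∣ (λ e → toℕ (π ⟨$⟩ˡ e) <? s) ⟩
  ∑ᶠ (λ e → χ (toℕ (π ⟨$⟩ˡ e) <? s))           ≡⟨ sum-permute _ π ⟩
  ∑ᶠ (λ i → χ (toℕ (π ⟨$⟩ˡ (π ⟨$⟩ʳ i)) <? s)) ≡⟨ sum-cong-≗ (λ i →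
                                                     cong (λ j → χ (toℕ j <? s)) (inverseˡ π {i})) ⟩
  ∑ᶠ {n} (λ i → χ (toℕ i <? s))                ≡⟨ ∑ᶠ-< s≤n ⟩
  s                                            ∎
  where open ≡-Reasoning

-- Recovers the ranks of prefixes from the sequence, which turns `Chain` into a condition on the
-- rank sequence alone.
partialSum : Vec (Fin 2) n → ℕ → ℕ
partialSum []      t       = 0
partialSum (x ∷ v) zero    = 0
partialSum (x ∷ v) (suc t) = toℕ x + partialSum v t

partialSum-telescope : ∀ {n} (g : ℕ → ℕ) → (∀ j → g j ≤ g (suc j)) →
  (lt : ∀ (i : Fin n) → g (suc (toℕ i)) ∸ g (toℕ i) < 2) → ∀ {t} → t ≤ n →
  partialSum (Vec.tabulate λ i → fromℕ< (lt i)) t + g 0 ≡ g t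
partialSum-telescope {zero}  g mono lt z≤n = refl
partialSum-telescope {suc n} g mono lt z≤n = refl
partialSum-telescope {suc n} g mono lt {suc t} (s≤s t≤n) = begin
  toℕ (fromℕ< (lt zero)) + rest + g 0 ≡⟨ cong (λ d → d + rest + g 0) (Fin.toℕ-fromℕ< (lt zero)) ⟩
  (g 1 ∸ g 0) + rest + g 0            ≡⟨ rearrange (g 1 ∸ g 0) rest (g 0) ⟩
  rest + ((g 1 ∸ g 0) + g 0)          ≡⟨ cong (rest +_) (m∸n+n≡m (mono 0)) ⟩
  rest + g 1                          ≡⟨ partialSum-telescope (g ∘ suc) (mono ∘ suc) (lt ∘ suc) t≤n ⟩
  g (suc t)                           ∎
  where
  open ≡-Reasoning
  rest = partialSum (Vec.tabulate λ i → fromℕ< (lt (suc i))) t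
  rearrange : ∀ a b c → a + b + c ≡ b + (a + c)
  rearrange = solve-∀

partialSum-rankSequence : ∀ (M : Matroid (⊤ {n})) π {t} → t ≤ n →
                          partialSum (rankSequence M π) t ≡ rank M (prefix π t)
partialSum-rankSequence M π {t} t≤n = begin
  partialSum (rankSequence M π) t                       ≡⟨ +-identityʳ _ ⟨
  partialSum (rankSequence M π) t + 0                   ≡⟨ cong (partialSum (rankSequence M π) t +_) empty ⟨
  partialSum (rankSequence M π) t + rank M (prefix π 0) ≡⟨ partialSum-telescope (rank M ∘ prefix π)
                                                            (λ j → rank-mono M (prefix-mono π j) ⊆⊤)
                                                            (increment<2 M π) t≤n ⟩
  rank M (prefix π t)                                   ∎
  where
  open ≡-Reasoning
  empty : rank M (prefix π 0) ≡ 0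
  empty = rank-⊥ M λ e∈ → contradiction (∈-prefix⁻ π {j = 0} e∈) λ ()

Chain-cong : ∀ {a j m k} {ρ ρ′ : ℕ → ℕ} → (∀ {t} → t ≤ a + (j + m) → ρ t ≡ ρ′ t) →
             Chain a j m k ρ → Chain a j m k ρ′
Chain-cong {a} {j} {m} ρ≗ρ′ (≡k , ≤k , ≤k′) =
  trans (sym (ρ≗ρ′ (+-monoʳ-≤ a (m≤m+n j m)))) ≡k ,
  subst (λ x → x + j ≤ _) (ρ≗ρ′ (m≤m+n a (j + m))) ≤k ,
  subst (_≤ _) (ρ≗ρ′ ≤-refl) ≤k′

_≟ᵏ_ : DecidableEquality (ℕ × ℕ)
_≟ᵏ_ = Product.≡-dec _≟_ _≟_

private
  module Keys = Multiplicity _≟ᵏ_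

-- Among the orderings whose first s elements are a given set X with ∣ X ∣ ≡ s, the number of
-- those in which the last j elements of X are among the c coloops of M|X and the next m
-- elements are among the l loops of M/X.
kernel : (n s : ℕ) → ℕ × ℕ → ℕ × ℕ → ℕ
kernel n s (c , l) (j , m) =
  arrangements {n} (phase (s ∸ j) j m ∘ toℕ) (profile (s ∸ c) c l ((n ∸ s) ∸ l))

-- The range in which a `phase` word has length `n`. Written as `s + m ≤ n`, the second bound also
-- excludes `s > n`, where `n ∸ s` would be truncated.
Fits : (n s : ℕ) → ℕ × ℕ → Set
Fits n s (j , m) = j ≤ s × s + m ≤ n

module _ {n s : ℕ} where

  tally-phase-fits : ∀ {j m} → Fits n s (j , m) → ∀ b →
    tally {n} (phase (s ∸ j) j m ∘ toℕ) b ≡ profile (s ∸ j) j m ((n ∸ s) ∸ m) b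
  tally-phase-fits {j} {m} (j≤s , s+m≤n) b =
    subst (λ n′ → tally {n′} (phase (s ∸ j) j m ∘ toℕ) b ≡ profile (s ∸ j) j m ((n ∸ s) ∸ m) b)
      total (tally-phase (s ∸ j) j m ((n ∸ s) ∸ m) b)
    where
    open ≡-Reasoning
    total : (s ∸ j) + (j + (m + ((n ∸ s) ∸ m))) ≡ n
    total = begin
      (s ∸ j) + (j + (m + ((n ∸ s) ∸ m))) ≡⟨ +-assoc (s ∸ j) j _ ⟨
      (s ∸ j) + j + (m + ((n ∸ s) ∸ m))   ≡⟨ cong₂ _+_ (m∸n+n≡m j≤s)
        (m+[n∸m]≡n (m+n≤o⇒m≤o∸n m (≤-trans (≤-reflexive (+-comm m s)) s+m≤n))) ⟩
      s + (n ∸ s)                         ≡⟨ m+[n∸m]≡n (m+n≤o⇒m≤o s s+m≤n) ⟩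
      n                                   ∎

  fits-weight : ∀ {q} → Fits n s q → proj₁ q + proj₂ q ≤ n
  fits-weight {j , m} (j≤s , s+m≤n) = ≤-trans (+-monoˡ-≤ m j≤s) s+m≤n

  kernel-diagonal : ∀ {q} → Fits n s q → kernel n s q q ≢ 0
  kernel-diagonal fits = arrangements-≢0 {n} _ λ b → sym (tally-phase-fits fits b)

  -- Either a special colour is too scarce for the word, or `c ≥ j` and `l ≥ m`; in the latter case
  -- the weights force both to be equalities, against `p ≢ q`.
  kernel-off-diagonal : ∀ {p q} → Fits n s q → p ≢ q → proj₁ p + proj₂ p ≤ proj₁ q + proj₂ q →
                        kernel n s p q ≡ 0
  kernel-off-diagonal {c , l} {j , m} fits p≢q c+l≤j+m with c <? j | l <? m
  ... | yes c<j | _       = arrangements-zero {n} _ _ true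
    (<-≤-trans c<j (≤-reflexive (sym (tally-phase-fits fits (true , true)))))
  ... | _       | yes l<m = arrangements-zero {n} _ _ false
    (<-≤-trans l<m (≤-reflexive (sym (tally-phase-fits fits (false , true)))))
  ... | no c≮j  | no l≮m  = contradiction (cong₂ _,_ c≡j l≡m) p≢q
    where
    c≡j : c ≡ j
    c≡j = ≤-antisym (+-cancelʳ-≤ l c j (≤-trans c+l≤j+m (+-monoʳ-≤ j (≮⇒≥ l≮m)))) (≮⇒≥ c≮j)
    l≡m : l ≡ m
    l≡m = ≤-antisym (+-cancelˡ-≤ c l m (≤-trans c+l≤j+m (+-monoˡ-≤ m (≮⇒≥ c≮j)))) (≮⇒≥ l≮m)

-- Keys of sets and double counting of orderings

module _ (M : Matroid (⊤ {n})) where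

  -- `coloopCount` has the form used in `flatCount` and is matched with a tally afterwards;
  -- `loopCount` can be a tally from the start.
  coloopCount loopCount : Subset n → ℕ
  coloopCount X = ∣ coloops (restrict M X ⊆⊤) ∣
  loopCount X = tally (colouring M X) (false , true)

  key : Subset n → ℕ × ℕ
  key X = coloopCount X , loopCount X

  private
    tally-side : ∀ X x → tally (colouring M X) (x , true) + tally (colouring M X) (x , false) ≡
                         ∑ᶠ λ e → χ (does (e ∈? X) Bool.≟ x)
    tally-side X x = trans (sym (∑-distrib-+ (λ e → χ (colouring M X e ≟ᶜ (x , true))) _))
      (sum-cong-≗ λ e → split (does (e ∈? X)) (does (special? M X e)) x)
      where
      split : ∀ y z x → χ ((y , z) ≟ᶜ (x , true)) + χ ((y , z) ≟ᶜ (x , false)) ≡ χ (y Bool.≟ x)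
      split true  true  true  = refl
      split true  true  false = refl
      split true  false true  = refl
      split true  false false = refl
      split false true  true  = refl
      split false true  false = refl
      split false false true  = refl
      split false false false = refl

    tally-inside : ∀ X → tally (colouring M X) (true , true) + tally (colouring M X) (true , false) ≡ ∣ X ∣
    tally-inside X = trans (tally-side X true) (trans
      (sum-cong-≗ λ e → χ-⇔ (does (e ∈? X) Bool.≟ true) (e ∈? X) (does-true (e ∈? X)) (dec-true (e ∈? X)))
      (sym (∣p∣≡∑ᶠ X)))

    tally-outside : ∀ X → tally (colouring M X) (false , true) + tally (colouring M X) (false , false) ≡ n ∸ ∣ X ∣
    tally-outside X = trans (sym (m+n∸m≡n ∣ X ∣ _)) (cong (_∸ ∣ X ∣) (begin
      ∣ X ∣ + (t (false , true) + t (false , false))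
        ≡⟨ cong₂ _+_ (trans (sym (tally-inside X)) (tally-side X true)) (tally-side X false) ⟩
      ∑ᶠ (λ e → χ (does (e ∈? X) Bool.≟ true)) + ∑ᶠ (λ e → χ (does (e ∈? X) Bool.≟ false))
        ≡⟨ ∑-distrib-+ (λ e → χ (does (e ∈? X) Bool.≟ true)) _ ⟨
      ∑ᶠ (λ e → χ (does (e ∈? X) Bool.≟ true) + χ (does (e ∈? X) Bool.≟ false))
        ≡⟨ sum-cong-≗ (λ e → χ-Bool (does (e ∈? X))) ⟩
      ∑ᶠ {n} (λ _ → 1)
        ≡⟨ ∑ᶠ-one n ⟩
      n ∎))
      where
      open ≡-Reasoning
      t = tally (colouring M X)
      χ-Bool : ∀ x → χ (x Bool.≟ true) + χ (x Bool.≟ false) ≡ 1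
      χ-Bool true  = refl
      χ-Bool false = refl

  colouring-coloop : ∀ X e → colouring M X e ≡ (true , true) → IsColoop (restrict M X ⊆⊤) e
  colouring-coloop X e eq = rank-drops⇒coloop M e∈X
    (proj₁ (does-true (special? M X e) (cong proj₂ eq)) e∈X)
    where
    e∈X : e ∈ X
    e∈X = does-true (e ∈? X) (cong proj₁ eq)

  coloop-colouring : ∀ X e → IsColoop (restrict M X ⊆⊤) e → colouring M X e ≡ (true , true)
  coloop-colouring X e coloop@(e∈X , _) = cong₂ _,_ (dec-true (e ∈? X) e∈X)
    (dec-true (special? M X e) ((λ _ → coloop⇒rank-drops M coloop) , contradiction e∈X))

  coloopCount-tally : ∀ X → tally (colouring M X) (true , true) ≡ coloopCount X
  coloopCount-tally X = trans
    (sum-cong-≗ λ e → χ-⇔ (colouring M X e ≟ᶜ (true , true)) (isColoop? (restrict M X ⊆⊤) e)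
      (colouring-coloop X e) (coloop-colouring X e))
    (sym (∣tabulate∣ (isColoop? (restrict M X ⊆⊤))))

  -- The size of `X` and its key fix all four tallies. Hence the number of arrangements over `X`
  -- depends on nothing else.
  tally-colouring : ∀ X b → tally (colouring M X) b ≡
    profile (∣ X ∣ ∸ coloopCount X) (coloopCount X) (loopCount X) ((n ∸ ∣ X ∣) ∸ loopCount X) b
  tally-colouring X (true  , true)  = coloopCount-tally X
  tally-colouring X (true  , false) = trans (sym (m+n∸m≡n (t (true , true)) _))
    (cong₂ _∸_ (tally-inside X) (coloopCount-tally X))
    where t = tally (colouring M X)
  tally-colouring X (false , true)  = refl
  tally-colouring X (false , false) = trans (sym (m+n∸m≡n (loopCount X) _))
    (cong (_∸ loopCount X) (tally-outside X))

  key-fits : ∀ X → Fits n ∣ X ∣ (key X)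
  key-fits X = m+n≤o⇒m≤o _ (≤-reflexive (trans (cong (_+ tally (colouring M X) (true , false))
                 (sym (coloopCount-tally X))) (tally-inside X))) ,
    ≤-trans (+-monoʳ-≤ ∣ X ∣ (m+n≤o⇒m≤o (loopCount X) (≤-reflexive (tally-outside X))))
            (≤-reflexive (m+[n∸m]≡n (∣p∣≤n X)))

  flat⇒loopCount≡0 : ∀ X → IsFlat M X → loopCount X ≡ 0
  flat⇒loopCount≡0 X (_ , grows) = ∑ᶠ-zero λ e → χ-false (colouring M X e ≟ᶜ (false , true)) λ eq →
    let e∉X = λ e∈X → contradiction (trans (sym (dec-true (e ∈? X) e∈X)) (cong proj₁ eq)) λ ()
    in <⇒≱ (grows e ∈⊤ e∉X) (proj₂ (does-true (special? M X e) (cong proj₂ eq)) e∉X)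

  loopCount≡0⇒flat : ∀ X → loopCount X ≡ 0 → IsFlat M X
  loopCount≡0⇒flat X ≡0 = ⊆⊤ , λ e _ e∉X → ≰⇒> λ loop → contradiction
    (trans (sym (χ-true (colouring M X e ≟ᶜ (false , true)) (cong₂ _,_ (dec-false (e ∈? X) e∉X)
        (dec-true (special? M X e) ((λ e∈X → contradiction e∈X e∉X) , λ _ → loop)))))
      (∑ᶠ≡0 (λ e → χ (colouring M X e ≟ᶜ (false , true))) ≡0 e)) λ ()

  module _ (k s : ℕ) where

    Selected : Subset n → Set
    Selected X = ∣ X ∣ ≡ s × rank M X ≡ k

    selected? : Decidable Selected
    selected? X = ∣ X ∣ ≟ s ×-dec rank M X ≟ k

    -- The unknown of the triangular system: the multiset of keys of all sets of this size and rank,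
    -- flats or not.
    keys : List (ℕ × ℕ)
    keys = map key (filter selected? (allSubsets n))

    keys-fit : ∀ {q} → q List.∈ keys → Fits n s q
    keys-fit q∈ with X , X∈ , refl ← ∈-map⁻ key q∈
      with refl , _ ← proj₂ (∈-filter⁻ selected? {xs = allSubsets n} X∈) = key-fits X

    ∑-keys : ∀ f → ∑ keys f ≡ ∑ (allSubsets n) (λ X → χ (selected? X) * f (key X))
    ∑-keys f = trans (∑-map key (filter selected? (allSubsets n)) f)
      (∑-filter selected? (allSubsets n) (f ∘ key))

    flatCount-keys : ∀ c → flatCount M k s c ≡ Keys.count (c , 0) keys
    flatCount-keys c = trans (length-filter _ (allSubsets n)) (sym (trans (∑-keys _)
      (∑-cong (allSubsets n) λ X → trans (sym (χ-× (selected? X) ((c , 0) ≟ᵏ key X)))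
        (χ-⇔ {Q = IsFlat M X × rank M X ≡ k × ∣ X ∣ ≡ s × coloopCount X ≡ c}
          (selected? X ×-dec (c , 0) ≟ᵏ key X)
          (isFlat? M X ×-dec rank M X ≟ k ×-dec ∣ X ∣ ≟ s ×-dec coloopCount X ≟ c)
          (λ { ((size , rk) , eq) → loopCount≡0⇒flat X (sym (cong proj₂ eq)) , rk , size , sym (cong proj₁ eq) })
          (λ { (flat , rk , size , refl) → (size , rk) , cong (c ,_) (sym (flat⇒loopCount≡0 X flat)) })))))

    -- Double counting: the orderings are sorted by the set `X` of their first `s` elements. Sets of
    -- another size are never such a prefix, and sets of another rank violate the first condition of
    -- `Chain`.
    ∑-chains : ∀ {j m} → Fits n s (j , m) →
      ∑ (permutations n) (λ π → χ (chain? (s ∸ j) j m k (partialSum (rankSequence M π)))) ≡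
      ∑ keys (λ x → kernel n s x (j , m))
    ∑-chains {j} {m} (j≤s , s+m≤n) = begin
      ∑ perms χ-chain
        -- Each subset is listed exactly once, so the indicators of `prefix π s ≟ˢ X` sum to 1 over
        -- all `X`.
        ≡⟨ ∑-cong perms (λ π → sym (trans (Subsets.∑-select (prefix π s) (allSubsets n) (λ _ → χ-chain π))
             (trans (cong (_* χ-chain π) (count-allSubsets (prefix π s))) (*-identityˡ (χ-chain π))))) ⟩
      ∑ perms (λ π → ∑ (allSubsets n) λ X → χ (prefix π s ≟ˢ X) * χ-chain π)
        ≡⟨ ∑-swap perms (allSubsets n) _ ⟩
      ∑ (allSubsets n) (λ X → ∑ perms λ π → χ (prefix π s ≟ˢ X) * χ-chain π)
        ≡⟨ ∑-cong (allSubsets n) (λ X → by-set X (selected? X)) ⟩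
      ∑ (allSubsets n) (λ X → χ (selected? X) * kernel n s (key X) (j , m))
        ≡⟨ ∑-keys _ ⟨
      ∑ keys (λ x → kernel n s x (j , m)) ∎
      where
      open ≡-Reasoning
      perms = permutations n
      a = s ∸ j
      a+j≡s : a + j ≡ s
      a+j≡s = m∸n+n≡m j≤s
      bound : a + (j + m) ≤ n
      bound = ≤-trans (≤-reflexive (trans (sym (+-assoc a j m)) (cong (_+ m) a+j≡s))) s+m≤n
      chain-rank? : ∀ π → Dec (Chain a j m k (partialSum (rankSequence M π)))
      chain-rank? π = chain? a j m k (partialSum (rankSequence M π))
      χ-chain : Permutation′ n → ℕ
      χ-chain π = χ (chain-rank? π)
      to-rank : ∀ π → Chain a j m k (partialSum (rankSequence M π)) → Chain a j m k (rank M ∘ prefix π)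
      to-rank π = Chain-cong λ t≤ → partialSum-rankSequence M π (≤-trans t≤ bound)
      from-rank : ∀ π → Chain a j m k (rank M ∘ prefix π) → Chain a j m k (partialSum (rankSequence M π))
      from-rank π = Chain-cong λ t≤ → sym (partialSum-rankSequence M π (≤-trans t≤ bound))
      word : Fin n → Colour
      word = phase a j m ∘ toℕ
      by-set : ∀ X → Dec (Selected X) → ∑ perms (λ π → χ (prefix π s ≟ˢ X) * χ-chain π) ≡
               χ (selected? X) * kernel n s (key X) (j , m)
      by-set X (yes sel@(refl , rk)) = begin
        ∑ perms (λ π → χ (prefix π s ≟ˢ X) * χ-chain π)
          ≡⟨ ∑-cong perms (λ π → trans (sym (χ-× (prefix π s ≟ˢ X) (chain-rank? π)))
               (χ-⇔ (prefix π s ≟ˢ X ×-dec chain-rank? π) (arrangement? word (colouring M X) π)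
                 (λ { (P≡X , chain) → chain⇒arrangement M π {X} {a} {j} {m} bound rk
                        (trans (cong (prefix π) a+j≡s) P≡X) (to-rank π chain) })
                 (λ arr → trans (cong (prefix π) (sym a+j≡s)) (arrangement⇒prefix M π {X} {a} {j} {m} bound rk arr) ,
                          from-rank π (arrangement⇒chain M π {X} {a} {j} {m} bound rk arr)))) ⟩
        ∑ perms (χ ∘ arrangement? word (colouring M X))
          ≡⟨ count-arrangements word (colouring M X) ⟩
        arrangements word (tally (colouring M X))
          ≡⟨ arrangements-cong word (tally-colouring X) ⟩
        kernel n s (key X) (j , m)
          ≡⟨ *-identityˡ _ ⟨
        1 * kernel n s (key X) (j , m)
          ≡⟨ cong (_* kernel n s (key X) (j , m)) (χ-true (selected? X) sel) ⟨
        χ (selected? X) * kernel n s (key X) (j , m) ∎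
      by-set X (no ¬sel) = trans (∑-zero perms vanish)
        (cong (_* kernel n s (key X) (j , m)) (sym (χ-false (selected? X) ¬sel)))
        where
        vanish : ∀ π → χ (prefix π s ≟ˢ X) * χ-chain π ≡ 0
        vanish π = trans (sym (χ-× (prefix π s ≟ˢ X) (chain-rank? π)))
          (χ-false (prefix π s ≟ˢ X ×-dec chain-rank? π) λ { (refl , chain) → ¬sel
            (∣prefix∣ π (m+n≤o⇒m≤o s s+m≤n) ,
             trans (cong (rank M ∘ prefix π) (sym a+j≡s)) (proj₁ (to-rank π chain))) })

-- From the 𝒢-invariant to the multiset of rank sequences

_≟ᵛ_ : DecidableEquality (Vec (Fin 2) n)
_≟ᵛ_ = ≡-dec Fin._≟_

private
  module Sequences {n} = Multiplicity (_≟ᵛ_ {n})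

rankSequences : Matroid (⊤ {n}) → List (Vec (Fin 2) n)
rankSequences M = map (rankSequence M) (permutations _)

flatCount-determined : ∀ (M M′ : Matroid (⊤ {n})) →
  (∀ v → Sequences.count v (rankSequences M) ≡ Sequences.count v (rankSequences M′)) →
  ∀ k s c → flatCount M k s c ≡ flatCount M′ k s c
flatCount-determined {n} M M′ same k s c = begin
  flatCount M k s c                                ≡⟨ flatCount-keys M k s c ⟩
  Keys.count (c , 0) (keys M k s)     ≡⟨ Keys.Triangular.counts≡ (Fits n s) weight (kernel n s) n
    (fits-weight {n} {s}) (kernel-diagonal {n} {s}) (kernel-off-diagonal {n} {s}) (keys M k s) (keys M′ k s)
    (keys-fit M k s) (keys-fit M′ k s) sums≡ (c , 0) ⟩
  Keys.count (c , 0) (keys M′ k s)    ≡⟨ flatCount-keys M′ k s c ⟨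
  flatCount M′ k s c                               ∎
  where
  open ≡-Reasoning
  weight : ℕ × ℕ → ℕ
  weight (j , m) = j + m
  sums≡ : ∀ {q} → Fits n s q → ∑ (keys M k s) (λ x → kernel n s x q) ≡ ∑ (keys M′ k s) (λ x → kernel n s x q)
  sums≡ {j , m} fits = begin
    ∑ (keys M k s) (λ x → kernel n s x (j , m))                ≡⟨ ∑-chains M k s fits ⟨
    ∑ (permutations n) (χ-chain ∘ rankSequence M)              ≡⟨ ∑-map (rankSequence M) (permutations n) χ-chain ⟨
    ∑ (rankSequences M) χ-chain                                ≡⟨ Sequences.∑-determined χ-chain
                                                                    (rankSequences M) (rankSequences M′)
                                                                    (λ v _ → same v) ⟩
    ∑ (rankSequences M′) χ-chain                               ≡⟨ ∑-map (rankSequence M′) (permutations n) χ-chain ⟩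
    ∑ (permutations n) (χ-chain ∘ rankSequence M′)             ≡⟨ ∑-chains M′ k s fits ⟩
    ∑ (keys M′ k s) (λ x → kernel n s x (j , m))               ∎
    where
    χ-chain : Vec (Fin 2) n → ℕ
    χ-chain v = χ (chain? (s ∸ j) j m k (partialSum v))

module _ {a ℓ₁ ℓ₂ : Level} (K : HeytingField a ℓ₁ ℓ₂) (char0 : CharacteristicZero K) where

  private
    module K = CommutativeRing
      (HeytingCommutativeRing.commutativeRing (HeytingField.heytingCommutativeRing K))
  open RawMonoidDefs K.+-rawMonoid using () renaming (_×_ to _×ᴷ_)

  ×1-injective : ∀ m m′ → m ×ᴷ K.1# K.≈ m′ ×ᴷ K.1# → m ≡ m′
  ×1-injective zero    zero     eq = refl
  ×1-injective zero    (suc m′) eq = contradiction (K.sym eq) (char0 m′)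
  ×1-injective (suc m) zero     eq = contradiction eq (char0 m)
  ×1-injective (suc m) (suc m′) eq = cong suc (×1-injective m m′
    (AbelianGroupProperties.∙-cancelˡ K.+-abelianGroup K.1# _ _ eq))

  𝒢-coefficient : ∀ {n r} (M : Matroid (⊤ {n})) (rkM : rk M ≡ r) (s : Symbol n r) →
    𝒢-invariant K M rkM s K.≈ Sequences.count (proj₁ s) (rankSequences M) ×ᴷ K.1#
  𝒢-coefficient {n} {r} M rkM s = go (permutations n)
    where
    open LeftModule (𝒢 K n r) using (_+ᴹ_; 0ᴹ)
    go : ∀ πs → foldr (λ π v → [_] K (rankSymbol M rkM π) +ᴹ v) 0ᴹ πs s K.≈
         Sequences.count (proj₁ s) (map (rankSequence M) πs) ×ᴷ K.1#
    go []       = K.refl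
    -- `[_]` and `Sequences.count` test the same equality with its sides swapped, so both decisions
    -- are split and the mixed cases refuted.
    go (π ∷ πs) with rankSequence M π ≟ᵛ proj₁ s | proj₁ s ≟ᵛ rankSequence M π
    ... | yes _  | yes _  = K.+-congˡ (go πs)
    ... | no _   | no _   = K.trans (K.+-congˡ (go πs)) (K.+-identityˡ _)
    ... | yes eq | no neq = contradiction (sym eq) neq
    ... | no neq | yes eq = contradiction (sym eq) neq

proposition5p5 :
    ∀ {a ℓ₁ ℓ₂ : Level} (K : HeytingField a ℓ₁ ℓ₂) → CharacteristicZero K →
    ∀ {n r : ℕ} (M M′ : Matroid (⊤ {n})) (rkM : rk M ≡ r) (rkM′ : rk M′ ≡ r) →
    LeftModule._≈ᴹ_ (𝒢 K n r) (𝒢-invariant K M rkM) (𝒢-invariant K M′ rkM′) →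
    ∀ (k s c : ℕ) → k ≤ r → flatCount M k s c ≡ flatCount M′ k s c
proposition5p5 K char0 {n} {r} M M′ rkM rkM′ 𝒢≈ k s c _ = flatCount-determined M M′ same k s c
  where
  module K = CommutativeRing
    (HeytingCommutativeRing.commutativeRing (HeytingField.heytingCommutativeRing K))
  -- A sequence without exactly `r` ones is no symbol, so the equality of invariants says nothing
  -- about it; it is the rank sequence of no ordering of either matroid.
  absent : ∀ (N : Matroid (⊤ {n})) → rk N ≡ r → ∀ v → ones v ≢ r →
           Sequences.count v (rankSequences N) ≡ 0
  absent N rkN v ones≢r = trans (∑-map (rankSequence N) (permutations n) _)
    (∑-zero (permutations n) λ π → χ-false (v ≟ᵛ rankSequence N π)
      λ { refl → ones≢r (trans (ones-rankSequence N π) rkN) })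
  same : ∀ v → Sequences.count v (rankSequences M) ≡ Sequences.count v (rankSequences M′)
  same v with ones v ≟ r
  ... | yes ones≡r = ×1-injective K char0 _ _
    (K.trans (K.sym (𝒢-coefficient K char0 M rkM (v , ones≡r)))
      (K.trans (𝒢≈ (v , ones≡r)) (𝒢-coefficient K char0 M′ rkM′ (v , ones≡r))))
  ... | no ones≢r = trans (absent M rkM v ones≢r) (sym (absent M′ rkM′ v ones≢r))
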